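{- Let $\lambda>1/2$. Then there exists a positive constant $f(\lambda)$ such that, in the $N$-balanced model, $\mathrm{err}_N(G_{n,\lambda n})\geq f(\lambda)$ with high probability as $n$ grows; that is, for every $\epsilon>0$ there exists $M$ such that $\mathbb{P}\big(\mathrm{err}_N(G_{n,\lambda n})\geq f(\lambda)\big)\geq 1-\epsilon$ for all $N\geq 1$ and all $n\geq M$.
   Context: $G_{n,m}$ denotes a uniformly random simple graph with vertex set $\{1,\dots,n\}$ and $m$ edges; $G_{n,\lambda n}$ means $m=\lambda n$ (rounded down to an integer). CU-process on a graph $G=(V,E)$: each vertex $v$ carries a counter $c_v$ with initial value $0$. At each step an edge $e=\{u,v\}\in E$ is drawn, and those of the counters $c_u,c_v$ that equal $\min(c_u,c_v)$ (values before the step) are simultaneously incremented by $1$; all other counters do not change. $c_v(t)$ is the value of $c_v$ after $t$ steps, and for an edge $e=\{u,v\}$, $c_e(t)=\min(c_u(t),c_v(t))$. $N$-balanced model ($N\geq 1$ an integer, $m=|E|$): the sequence of $Nm$ drawn edges is a uniformly random permutation of the multiset containing $N$ copies of each edge of $E$. Set $c_e^{(N)}=c_e(Nm)$; the relative error of $e$ is $R_e^{(N)}=(c_e^{(N)}-N)/N$, and the average error is $\mathrm{err}_N(G)=\frac1m\sum_{e\in E}R_e^{(N)}$. Probability is over both the random graph and the random sequence. -}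

module Defs where

open import Data.Bool.Base using (Bool; if_then_else_; _∧_; _∨_)
open import Data.Empty using (⊥)
open import Data.Fin.Base using (Fin)
open import Data.Fin.Properties using (_≟_; _<?_)
open import Data.Integer.Base as ℤ using (+_)
open import Data.List.Base
  using (List; []; _∷_; _++_; map; concatMap; foldl; foldr; length; filter; replicate; allFin; cartesianProduct)
open import Data.Nat.Base as ℕ using (ℕ; zero; suc; NonZero)
import Data.Nat.Properties as ℕ
open import Data.Product.Base using (_×_; _,_; ∃-syntax; proj₁; proj₂)
open import Data.Rational.Base as ℚ using (ℚ; 0ℚ; 1ℚ; _/_)
import Data.Rational.Properties as ℚ
open import Data.Sum.Base using (_⊎_)
open import Relation.Nullary using (¬_; does)

-- Real numbers as two-sided located Dedekind cuts.

record ℝ : Set₁ where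
  field
    Lower : ℚ → Set
    Upper : ℚ → Set
    lower-inhabited : ∃[ q ] Lower q
    upper-inhabited : ∃[ q ] Upper q
    lower-closed    : ∀ {q r} → q ℚ.< r → Lower r → Lower q
    lower-open      : ∀ {q} → Lower q → ∃[ r ] (q ℚ.< r × Lower r)
    upper-closed    : ∀ {q r} → q ℚ.< r → Upper q → Upper r
    upper-open      : ∀ {r} → Upper r → ∃[ q ] (q ℚ.< r × Upper q)
    disjoint        : ∀ {q} → Lower q → Upper q → ⊥
    located         : ∀ {q r} → q ℚ.< r → Lower q ⊎ Upper r

infix 4 _ℚ<ℝ_ _ℝ<ℚ_ _ℚ≤ℝ_

_ℚ<ℝ_ : ℚ → ℝ → Set
q ℚ<ℝ x = ℝ.Lower x q

_ℝ<ℚ_ : ℝ → ℚ → Set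
x ℝ<ℚ q = ℝ.Upper x q

_ℚ≤ℝ_ : ℚ → ℝ → Set
q ℚ≤ℝ x = ¬ (x ℝ<ℚ q)

-- m = ⌊ x n ⌋, that is m ≤ x n < m + 1, with both inequalities divided by n.
-- A relation, because the floor of a real number is not computable.

IsFloor : ℕ → ℝ → (n : ℕ) → .{{NonZero n}} → Set
IsFloor m x n = (+ m / n ℚ≤ℝ x) × (x ℝ<ℚ + suc m / n)

-- Arithmetic mean over the entries of a list, counted with multiplicity, i.e.
-- the expectation of f at a uniformly random entry.  The value 0 on the empty
-- list makes every event have probability 0 on an empty sample space.

sumℚ : List ℚ → ℚ
sumℚ = foldr ℚ._+_ 0ℚ

average : ∀ {a} {A : Set a} → List A → (A → ℚ) → ℚ
average []       f = 0ℚ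
average (x ∷ xs) f = sumℚ (map f (x ∷ xs)) ℚ.* (+ 1 / length (x ∷ xs))

indicator : Bool → ℚ
indicator b = if b then 1ℚ else 0ℚ

-- The sublists of length k, in which every choice of k positions occurs once.

sublists : ∀ {a} {A : Set a} → ℕ → List A → List (List A)
sublists zero    _        = [] ∷ []
sublists (suc k) []       = []
sublists (suc k) (x ∷ xs) = map (x ∷_) (sublists k xs) ++ sublists (suc k) xs

-- All rearrangements of a list of length k, one for each of the k! permutations
-- of positions (so a list with repeated entries gives repeated rearrangements,
-- each distinct one equally often).

insertions : ∀ {a} {A : Set a} → A → List A → List (List A)
insertions x []       = (x ∷ []) ∷ []
insertions x (y ∷ ys) = (x ∷ y ∷ ys) ∷ map (y ∷_) (insertions x ys)

permutations : ∀ {a} {A : Set a} → List A → List (List A)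
permutations []       = [] ∷ []
permutations (x ∷ xs) = concatMap (insertions x) (permutations xs)

-- The edge {u, v} with u < v is the pair (u , v), and a graph on the vertex set
-- Fin n is its list of edges.

Edge : ℕ → Set
Edge n = Fin n × Fin n

Graph : ℕ → Set
Graph n = List (Edge n)

completeGraph : ∀ n → Graph n
completeGraph n =
  filter (λ e → proj₁ e <? proj₂ e) (cartesianProduct (allFin n) (allFin n))

graphs : (n m : ℕ) → List (Graph n)
graphs n m = sublists m (completeGraph n)

Counters : ℕ → Set
Counters n = Fin n → ℕ

edgeCounter : ∀ {n} → Counters n → Edge n → ℕ
edgeCounter c (u , v) = c u ℕ.⊓ c v

step : ∀ {n} → Counters n → Edge n → Counters n
step c e@(u , v) w =
  if (does (w ≟ u) ∨ does (w ≟ v)) ∧ does (c w ℕ.≟ edgeCounter c e)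
  then suc (c w)
  else c w

run : ∀ {n} → List (Edge n) → Counters n
run = foldl step (λ _ → 0)

balancedSequences : ∀ {n} → ℕ → Graph n → List (List (Edge n))
balancedSequences N G = permutations (concatMap (replicate N) G)

relativeError : ∀ {n} (N : ℕ) .{{_ : NonZero N}} → List (Edge n) → Edge n → ℚ
relativeError N σ e = (+ edgeCounter (run σ) e ℤ.- + N) / N

err : ∀ {n} (N : ℕ) .{{_ : NonZero N}} → Graph n → List (Edge n) → ℚ
err N G σ = average G (relativeError N σ)

-- The probability that err_N(G_{n,m}) ≥ f: first a uniformly random graph, then
-- independently uniform positions for the N copies of each of its edges.

ℙ[err≥_] : ℚ → (N : ℕ) .{{_ : NonZero N}} → (n m : ℕ) → ℚ
ℙ[err≥ f ] N n m =
  average (graphs n m) λ G →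
  average (balancedSequences N G) λ σ →
  indicator (does (f ℚ.≤? err N G σ))

{-# OPTIONS --safe #-}

-- Every vertex v lies on an edge whose counter is c_v (or is isolated, with c_v = 0),
-- and an edge serves at most two vertices; so the total error of the edges is at least half of
-- Σ (c_v − N) over any vertex set S.  Each draw of an edge inside S raises some c_v
-- with v ∈ S, hence this sum is at least N (e(S) − |S|), and it suffices to find,
-- with high probability, a set S for which e(S) − |S| is linear in n.
--
-- Such a set is the vertex set reached by an exploration.  For a small constant
-- fraction k of the vertices, query one active vertex at a time against all vertices
-- not yet reached; since 2m/n > 1 the answers activate more vertices than are used
-- up, so that linearly many active vertices remain in the current component.  The
-- pairs between them have not been queried, and they contain linearly many edges,
-- each of which closes a cycle.  The answers form a uniformly random bit string with
-- m ones, whatever the order of the queries: only the first k ρ answers and the last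
-- ones, for the pairs of active vertices, matter, and both are controlled by the
-- second moment.
module Submission where

open import Defs
open import Data.Bool.Base using (Bool; true; false; if_then_else_; _∧_; _∨_)
open import Data.Bool.Properties using (∨-zeroʳ)
open import Data.Fin.Base as Fin using (Fin; zero; suc)
open import Data.Fin.Properties as Fin using (_≟_)
open import Data.Fin.Subset using (Subset; ⊥)
open import Data.Fin.Subset.Properties using (anySubset?)
import Data.Integer.Base as ℤ
import Data.Integer.Properties as ℤ
open import Data.List.Base
  using (List; []; _∷_; [_]; _++_; _∷ʳ_; map; concatMap; foldl; length; replicate; take; drop; filter; allFin; cartesianProduct)
open import Data.List.Membership.Propositional using (_∈_)
open import Data.List.Membership.Propositional.Properties using (∈-++⁻; ∈-map⁻; ∈-concat⁻′)
open import Data.List.Properties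
  using (++-assoc; ++-identityʳ; filter-++; length-++; length-map; length-replicate; length-tabulate; length-take;
         map-++; map-cong; map-∘; take++drop≡id)
open import Data.List.Relation.Binary.Permutation.Propositional
  using (_↭_; prep; swap; ↭-refl; ↭-sym; ↭-trans; ↭-reflexive; module PermutationReasoning)
open import Data.List.Relation.Binary.Permutation.Propositional.Properties
  using (∈-resp-↭; filter-↭; map⁺; shift; shifts; ++⁺; ++⁺ˡ; ++-comm; ↭-length)
  renaming (++-assoc to ↭-assoc)
open import Data.List.Relation.Unary.All as All using (All; []; _∷_)
import Data.List.Relation.Unary.All.Properties as All
open import Data.List.Relation.Unary.AllPairs using ([]; _∷_)
open import Data.List.Relation.Unary.Any using (here; there)
open import Data.List.Relation.Unary.Unique.Propositional using (Unique)
open import Data.List.Relation.Unary.Unique.Propositional.Properties using (allFin⁺)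
open import Data.Nat.Base
open import Data.Nat.Combinatorics using (_C_; nCk+nC[k+1]≡[n+1]C[k+1]; k>n⇒nCk≡0; nC1≡n)
open import Data.Nat.DivMod using (m/n*n≤m; m*n/n≡m; /-monoˡ-≤; m≡m%n+[m/n]*n; m%n<n)
open import Data.Nat.ListAction using (sum)
open import Data.Nat.ListAction.Properties using (sum-↭; sum-++)
open import Data.Nat.Properties as ℕ hiding (_≟_)
open import Data.Nat.Tactic.RingSolver using (solve-∀)
open import Data.Product.Base using (_×_; _,_; ∃-syntax; proj₁; proj₂)
open import Data.Product.Properties using (≡-dec)
open import Data.Rational.Base as ℚ using (ℚ; 0ℚ; 1ℚ; ½; mkℚ; toℚᵘ)
import Data.Rational.Properties as ℚ
import Data.Rational.Unnormalised.Base as ℚᵘ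
import Data.Rational.Unnormalised.Properties as ℚᵘ
open import Data.Sum.Base using (_⊎_; inj₁; inj₂)
open import Data.Vec.Base using (_∷_; lookup; _[_]≔_)
open import Data.Vec.Properties using (lookup∘update; lookup∘update′; lookup-replicate)
open import Function.Base using (_∘_; const)
open import Function.Bundles using (mk⇔)
open import Relation.Binary.Definitions using (tri<; tri≈; tri>)
open import Relation.Binary.PropositionalEquality hiding ([_])
open import Relation.Nullary using (does; yes; no; Dec; contradiction)
open import Relation.Nullary.Decidable using (dec-true; dec-false; does-⇔; _×-dec_)

open import Algebra.Properties.CommutativeMonoid.Sum +-0-commutativeMonoid
  using (∑-distrib-+; sum-replicate-zero) renaming (sum to ∑)

-- Counters

-- Nothing has to be known about a giant component. When the current component is exhausted, a fresh
-- start vertex is activated. After k processed vertices, the active ones number at least the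
-- positive answers minus k, however often this happened; so a single count of ones replaces the
-- analysis of a random walk. The obstacle is that the queried pairs depend on earlier answers.
-- Conditional probabilities are avoided by an inequality between two counts: the good bit strings
-- with m ones are at most as many as the m-element edge sets with the required excess. It is proved
-- for all m at once, by induction along the queries (`Dominates`). The second moment applies to
-- fixed positions of a string, so goodness must not mention the course of the exploration. Hence
-- exactly k ρ answers are read at the front, although the number of queries varies, and exactly
-- `tri y` pairs of active vertices are moved to the end, although more may be available.

bit : Bool → ℕ
bit b = if b then 1 else 0

∑-mono-≤ : ∀ {n} {f g : Fin n → ℕ} → (∀ i → f i ≤ g i) → ∑ f ≤ ∑ g
∑-mono-≤ {zero}  f≤g = z≤n
∑-mono-≤ {suc n} f≤g = +-mono-≤ (f≤g zero) (∑-mono-≤ (f≤g ∘ suc))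

∑-mono-< : ∀ {n} {f g : Fin n → ℕ} → (∀ i → f i ≤ g i) → ∀ j → f j < g j → ∑ f < ∑ g
∑-mono-< f≤g zero    fj<gj = +-mono-<-≤ fj<gj (∑-mono-≤ (f≤g ∘ suc))
∑-mono-< f≤g (suc j) fj<gj = +-mono-≤-< (f≤g zero) (∑-mono-< (f≤g ∘ suc) j fj<gj)

∑-δ : ∀ {n} (u : Fin n) x → ∑ (λ v → bit (does (v ≟ u)) * x) ≡ x
∑-δ {suc n} zero    x = begin
  1 * x + ∑ {n} (const 0) ≡⟨ cong (1 * x +_) (sum-replicate-zero n) ⟩
  1 * x + 0               ≡⟨ +-identityʳ (1 * x) ⟩
  1 * x                   ≡⟨ *-identityˡ x ⟩
  x                       ∎
  where open ≡-Reasoning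
∑-δ {suc n} (suc u) x = ∑-δ u x

bit-∨ : ∀ a b → bit (a ∨ b) ≤ bit a + bit b
bit-∨ true  b = s≤s z≤n
bit-∨ false b = ≤-refl

bit≤1 : ∀ b → bit b ≤ 1
bit≤1 true  = ≤-refl
bit≤1 false = z≤n

module _ {a} {A : Set a} where

  total : (A → ℕ) → List A → ℕ
  total f xs = sum (map f xs)

  total-++ : ∀ f xs ys → total f (xs ++ ys) ≡ total f xs + total f ys
  total-++ f xs ys = trans (cong sum (map-++ f xs ys)) (sum-++ (map f xs) (map f ys))

  total-↭ : ∀ f {xs ys} → xs ↭ ys → total f xs ≡ total f ys
  total-↭ f xs↭ys = sum-↭ (map⁺ f xs↭ys)

  total-mono : ∀ {f g : A → ℕ} xs → (∀ x → x ∈ xs → f x ≤ g x) → total f xs ≤ total g xs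
  total-mono []       f≤g = z≤n
  total-mono (x ∷ xs) f≤g =
    +-mono-≤ (f≤g x (here refl)) (total-mono xs λ y y∈xs → f≤g y (there y∈xs))

  total-replicate : ∀ f N x → total f (replicate N x) ≡ N * f x
  total-replicate f zero    x = refl
  total-replicate f (suc N) x = cong (f x +_) (total-replicate f N x)

  total-copies : ∀ f N xs → total f (concatMap (replicate N) xs) ≡ N * total f xs
  total-copies f N []       = sym (*-zeroʳ N)
  total-copies f N (x ∷ xs) = begin
    total f (replicate N x ++ concatMap (replicate N) xs)
      ≡⟨ total-++ f (replicate N x) _ ⟩
    total f (replicate N x) + total f (concatMap (replicate N) xs)
      ≡⟨ cong₂ _+_ (total-replicate f N x) (total-copies f N xs) ⟩
    N * f x + N * total f xs
      ≡⟨ *-distribˡ-+ N (f x) _ ⟨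
    N * total f (x ∷ xs) ∎
    where open ≡-Reasoning

  ∈-replicate⁻ : ∀ {x y : A} N → y ∈ replicate N x → y ≡ x
  ∈-replicate⁻ (suc N) (here y≡x) = y≡x
  ∈-replicate⁻ (suc N) (there y∈) = ∈-replicate⁻ N y∈

  ∈-copies⁻ : ∀ {y : A} N xs → y ∈ concatMap (replicate N) xs → y ∈ xs
  ∈-copies⁻ N (x ∷ xs) y∈ with ∈-++⁻ (replicate N x) y∈
  ... | inj₁ y∈x  = here (∈-replicate⁻ N y∈x)
  ... | inj₂ y∈xs = there (∈-copies⁻ N xs y∈xs)

  ∈-insertions : ∀ (x : A) ys {zs} → zs ∈ insertions x ys → zs ↭ x ∷ ys
  ∈-insertions x []       (here refl) = ↭-refl
  ∈-insertions x (y ∷ ys) (here refl) = ↭-refl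
  ∈-insertions x (y ∷ ys) (there zs∈) with ∈-map⁻ (y ∷_) zs∈
  ... | ws , ws∈ , refl = ↭-trans (prep y (∈-insertions x ys ws∈)) (swap y x ↭-refl)

  ∈-permutations : ∀ (xs : List A) {zs} → zs ∈ permutations xs → zs ↭ xs
  ∈-permutations []       (here refl) = ↭-refl
  ∈-permutations (x ∷ xs) zs∈ with ∈-concat⁻′ (map (insertions x) (permutations xs)) zs∈
  ... | yss , zs∈yss , yss∈ with ∈-map⁻ (insertions x) yss∈
  ... | ys , ys∈ , refl = ↭-trans (∈-insertions x ys zs∈yss) (prep x (∈-permutations xs ys∈))

  insertions≢[] : ∀ (x : A) ys → NonZero (length (insertions x ys))
  insertions≢[] x []       = _
  insertions≢[] x (y ∷ ys) = _

  permutations≢[] : ∀ (xs : List A) → NonZero (length (permutations xs))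
  permutations≢[] []       = _
  permutations≢[] (x ∷ xs) with permutations xs | permutations≢[] xs
  ... | []      | ()
  ... | ys ∷ _ | _ with insertions x ys | insertions≢[] x ys
  ... | []     | ()
  ... | _ ∷ _ | _ = _

module _ {n : ℕ} where

  incident : Fin n → Edge n → Bool
  incident w (u , v) = does (w ≟ u) ∨ does (w ≟ v)

  inside : Subset n → Edge n → Bool
  inside S (u , v) = lookup S u ∧ lookup S v

  edgesIn : Subset n → Graph n → ℕ
  edgesIn S = total (bit ∘ inside S)

  sumOver : Subset n → Counters n → ℕ
  sumOver S c = ∑ λ v → bit (lookup S v) * c v

  card : Subset n → ℕ
  card S = ∑ λ v → bit (lookup S v)

  _≟ᴱ_ : (e e′ : Edge n) → Dec (e ≡ e′)
  _≟ᴱ_ = ≡-dec _≟_ _≟_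

  count : Edge n → List (Edge n) → ℕ
  count e = total λ e′ → bit (does (e ≟ᴱ e′))

  step-mono : ∀ (c : Counters n) e w → c w ≤ step c e w
  step-mono c (u , v) w with (does (w ≟ u) ∨ does (w ≟ v)) ∧ does (c w ℕ.≟ edgeCounter c (u , v))
  ... | true  = n≤1+n (c w)
  ... | false = ≤-refl

  step-changed : ∀ (c : Counters n) e w → step c e w ≡ c w ⊎ (incident w e ≡ true × step c e w ≡ suc (edgeCounter c e))
  step-changed c (u , v) w = cases (does (w ≟ u) ∨ does (w ≟ v)) (c w ℕ.≟ edgeCounter c (u , v))
    where
    cases : ∀ b (d : Dec (c w ≡ edgeCounter c (u , v))) →
            (if b ∧ does d then suc (c w) else c w) ≡ c w ⊎
            (b ≡ true × (if b ∧ does d then suc (c w) else c w) ≡ suc (edgeCounter c (u , v)))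
    cases false _        = inj₁ refl
    cases true  (no _)   = inj₁ refl
    cases true  (yes eq) = inj₂ (refl , cong suc eq)

  edgeCounter≤ : ∀ (c : Counters n) e w → incident w e ≡ true → edgeCounter c e ≤ c w
  edgeCounter≤ c (u , v) w inc with w ≟ u | w ≟ v
  ... | yes refl | _        = m⊓n≤m (c u) (c v)
  ... | no _     | yes refl = m⊓n≤n (c u) (c v)
  edgeCounter≤ c (u , v) w () | no _ | no _

  -- A counter at the minimum is raised above it, and any other counter of the edge exceeds it
  -- already. Applied to both ends this gives `step-edge`: a draw of an edge always raises the
  -- counter of that edge.
  step-incident : ∀ (c : Counters n) e w → incident w e ≡ true → edgeCounter c e < step c e w
  step-incident c e@(u , v) w inc = cases (incident w e) inc (c w ℕ.≟ edgeCounter c e)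
    where
    cases : ∀ b → b ≡ true → (d : Dec (c w ≡ edgeCounter c e)) →
            edgeCounter c e < (if b ∧ does d then suc (c w) else c w)
    cases true _ (yes eq) = s≤s (≤-reflexive (sym eq))
    cases true _ (no neq) = ≤∧≢⇒< (edgeCounter≤ c e w inc) (neq ∘ sym)

  incident-left : ∀ (u v : Fin n) → incident u (u , v) ≡ true
  incident-left u v rewrite dec-true (u ≟ u) refl = refl

  incident-right : ∀ (u v : Fin n) → incident v (u , v) ≡ true
  incident-right u v rewrite dec-true (v ≟ v) refl = ∨-zeroʳ _

  edgeCounter-mono : ∀ {c c′ : Counters n} → (∀ w → c w ≤ c′ w) → ∀ e → edgeCounter c e ≤ edgeCounter c′ e
  edgeCounter-mono c≤c′ (u , v) = ⊓-mono-≤ (c≤c′ u) (c≤c′ v)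

  step-edge : ∀ (c : Counters n) e → edgeCounter c e < edgeCounter (step c e) e
  step-edge c e@(u , v) =
    ⊓-glb (step-incident c e u (incident-left u v)) (step-incident c e v (incident-right u v))

  -- Draws of `e` raise its counter and no other draw lowers it. With `N` copies of every edge this
  -- yields c_e ≥ N, so no relative error is negative and the truncated subtraction used below is
  -- exact on edges.
  drawn≤counter : ∀ (e : Edge n) σ c → edgeCounter c e + count e σ ≤ edgeCounter (foldl step c σ) e
  drawn≤counter e []       c = ≤-reflexive (+-identityʳ _)
  drawn≤counter e (e′ ∷ σ) c = begin
    edgeCounter c e + (bit (does (e ≟ᴱ e′)) + count e σ)
      ≡⟨ +-assoc (edgeCounter c e) _ _ ⟨
    edgeCounter c e + bit (does (e ≟ᴱ e′)) + count e σ
      ≤⟨ +-monoˡ-≤ (count e σ) one ⟩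
    edgeCounter (step c e′) e + count e σ
      ≤⟨ drawn≤counter e σ (step c e′) ⟩
    edgeCounter (foldl step (step c e′) σ) e ∎
    where
    open ≤-Reasoning
    one : edgeCounter c e + bit (does (e ≟ᴱ e′)) ≤ edgeCounter (step c e′) e
    one with e ≟ᴱ e′
    ... | yes refl = ≤-trans (≤-reflexive (+-comm _ 1)) (step-edge c e)
    ... | no _     =
      ≤-trans (≤-reflexive (+-identityʳ _)) (edgeCounter-mono (step-mono c e′) e)

  -- If both ends lie in `S`, then so does an end that attains the minimum, and this end is
  -- incremented.
  step-sumOver : ∀ S c e → sumOver S c + bit (inside S e) ≤ sumOver S (step c e)
  step-sumOver S c e@(u , v) with lookup S u in Su | lookup S v in Sv
  ... | false | _     = ≤-trans (≤-reflexive (+-identityʳ _)) (∑-mono-≤ λ w → *-monoʳ-≤ (bit (lookup S w)) (step-mono c e w))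
  ... | true  | false = ≤-trans (≤-reflexive (+-identityʳ _)) (∑-mono-≤ λ w → *-monoʳ-≤ (bit (lookup S w)) (step-mono c e w))
  ... | true  | true  = ≤-trans (≤-reflexive (+-comm _ 1)) (strict (⊓-sel (c u) (c v)))
    where
    at : ∀ w → lookup S w ≡ true → incident w e ≡ true → edgeCounter c e ≡ c w →
         sumOver S c < sumOver S (step c e)
    at w Sw inc eq = ∑-mono-< (λ w → *-monoʳ-≤ (bit (lookup S w)) (step-mono c e w)) w
      (subst (λ b → bit b * c w < bit b * step c e w) (sym Sw)
        (*-monoʳ-< 1 (subst (_< step c e w) eq (step-incident c e w inc))))
    strict : edgeCounter c e ≡ c u ⊎ edgeCounter c e ≡ c v → sumOver S c < sumOver S (step c e)
    strict (inj₁ eq) = at u Su (incident-left u v) eq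
    strict (inj₂ eq) = at v Sv (incident-right u v) eq

  drawnInside≤sumOver : ∀ S σ c → sumOver S c + edgesIn S σ ≤ sumOver S (foldl step c σ)
  drawnInside≤sumOver S []      c = ≤-reflexive (+-identityʳ _)
  drawnInside≤sumOver S (e ∷ σ) c = begin
    sumOver S c + (bit (inside S e) + edgesIn S σ) ≡⟨ +-assoc (sumOver S c) _ _ ⟨
    sumOver S c + bit (inside S e) + edgesIn S σ   ≤⟨ +-monoˡ-≤ (edgesIn S σ) (step-sumOver S c e) ⟩
    sumOver S (step c e) + edgesIn S σ             ≤⟨ drawnInside≤sumOver S σ (step c e) ⟩
    sumOver S (foldl step (step c e) σ)            ∎
    where open ≤-Reasoning

  -- An inequality is enough, since `edgeCounter c e` never exceeds the counter of an end of `e`.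
  -- The alternative 0 covers the vertices that no draw has touched.
  Supported : Graph n → Counters n → Set
  Supported G c = ∀ v → c v ≡ 0 ⊎ ∃[ e ] (e ∈ G × incident v e ≡ true × c v ≤ edgeCounter c e)

  -- A counter that moved is now the old minimum plus one, and both ends of the drawn edge are at
  -- least that, so the drawn edge supports it. A counter that stayed keeps its old edge, whose
  -- counter can only have grown.
  step-supported : ∀ {G c e} → e ∈ G → Supported G c → Supported G (step c e)
  step-supported {G} {c} {e} e∈G sup v with step-changed c e v
  ... | inj₂ (inc , eq) = inj₂ (e , e∈G , inc , ≤-trans (≤-reflexive eq) (step-edge c e))
  ... | inj₁ eq with sup v
  ... | inj₁ cv≡0 = inj₁ (trans eq cv≡0)
  ... | inj₂ (e′ , e′∈G , inc , le) = inj₂ (e′ , e′∈G , inc ,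
    ≤-trans (≤-reflexive eq) (≤-trans le (edgeCounter-mono (step-mono c e) e′)))

  run-supported : ∀ {G} σ c → (∀ {e} → e ∈ σ → e ∈ G) → Supported G c → Supported G (foldl step c σ)
  run-supported []      c σ⊆G sup = sup
  run-supported (e ∷ σ) c σ⊆G sup =
    run-supported σ (step c e) (σ⊆G ∘ there) (step-supported (σ⊆G (here refl)) sup)

  -- Double counting: an edge is incident with at most two vertices. Equality could fail, because
  -- the type `Edge n` admits loops.
  charge : ∀ (x : Edge n → ℕ) G →
    ∑ (λ v → total (λ e → bit (incident v e) * x e) G) ≤ 2 * total x G
  charge x []      = ≤-reflexive (sum-replicate-zero n)
  charge x (e@(u , w) ∷ G) = begin
    ∑ (λ v → bit (incident v e) * x e + total (λ e′ → bit (incident v e′) * x e′) G)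
      ≡⟨ ∑-distrib-+ (λ v → bit (incident v e) * x e) _ ⟩
    ∑ (λ v → bit (incident v e) * x e) + ∑ (λ v → total (λ e′ → bit (incident v e′) * x e′) G)
      ≤⟨ +-mono-≤ two (charge x G) ⟩
    2 * x e + 2 * total x G
      ≡⟨ *-distribˡ-+ 2 (x e) _ ⟨
    2 * total x (e ∷ G) ∎
    where
    open ≤-Reasoning
    two : ∑ (λ v → bit (incident v e) * x e) ≤ 2 * x e
    two = begin
      ∑ (λ v → bit (incident v e) * x e)
        ≤⟨ ∑-mono-≤ (λ v → *-monoˡ-≤ (x e) (bit-∨ (does (v ≟ u)) (does (v ≟ w)))) ⟩
      ∑ (λ v → (bit (does (v ≟ u)) + bit (does (v ≟ w))) * x e)
        ≤⟨ ∑-mono-≤ (λ v → ≤-reflexive (*-distribʳ-+ (x e) (bit (does (v ≟ u))) (bit (does (v ≟ w))))) ⟩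
      ∑ (λ v → bit (does (v ≟ u)) * x e + bit (does (v ≟ w)) * x e)
        ≡⟨ ∑-distrib-+ (λ v → bit (does (v ≟ u)) * x e) _ ⟩
      ∑ (λ v → bit (does (v ≟ u)) * x e) + ∑ (λ v → bit (does (v ≟ w)) * x e)
        ≡⟨ cong₂ _+_ (∑-δ u (x e)) (∑-δ w (x e)) ⟩
      x e + x e
        ≡⟨ cong (x e +_) (+-identityʳ (x e)) ⟨
      2 * x e ∎

  Excess : ℕ → Graph n → Set
  Excess X G = ∃[ S ] (card S + X ≤ edgesIn S G)

  total-∈ : ∀ (f : Edge n → ℕ) {e G} → e ∈ G → f e ≤ total f G
  total-∈ f (here refl) = m≤m+n _ _
  total-∈ f {e} {e′ ∷ G} (there e∈G) = ≤-trans (total-∈ f e∈G) (m≤n+m _ (f e′))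

  module _ (N : ℕ) {G : Graph n} {σ : List (Edge n)} (σ∈ : σ ∈ balancedSequences N G) where

    private
      σ↭ : σ ↭ concatMap (replicate N) G
      σ↭ = ∈-permutations _ σ∈

      c : Counters n
      c = run σ

    drawn : ∀ (f : Edge n → ℕ) → total f σ ≡ N * total f G
    drawn f = trans (total-↭ f σ↭) (total-copies f N G)

    N≤edgeCounter : ∀ {e} → e ∈ G → N ≤ edgeCounter c e
    N≤edgeCounter {e} e∈G = begin
      N               ≡⟨ *-identityʳ N ⟨
      N * 1           ≤⟨ *-monoʳ-≤ N (subst (λ b → bit b ≤ count e G) (dec-true (e ≟ᴱ e) refl) (total-∈ _ e∈G)) ⟩
      N * count e G   ≡⟨ drawn (λ e′ → bit (does (e ≟ᴱ e′))) ⟨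
      count e σ       ≤⟨ drawn≤counter e σ (const 0) ⟩
      edgeCounter c e ∎
      where open ≤-Reasoning

    -- The draws inside `S` give N e(S) ≤ Σ c_v ≤ N |S| + Σ (c_v ∸ N), with sums over `S`;
    -- cancelling N |S| leaves N X below the total surplus. Each vertex then charges its surplus to
    -- its supporting edge.
    excess⇒error : ∀ {X} → Excess X G → N * X ≤ 2 * total (λ e → edgeCounter c e ∸ N) G
    excess⇒error {X} (S , ex) = begin
      N * X
        ≤⟨ +-cancelˡ-≤ (card S * N) _ _ main ⟩
      ∑ (λ v → bit (lookup S v) * (c v ∸ N))
        ≤⟨ ∑-mono-≤ one ⟩
      ∑ (λ v → total (λ e → bit (incident v e) * (edgeCounter c e ∸ N)) G)
        ≤⟨ charge _ G ⟩
      2 * total (λ e → edgeCounter c e ∸ N) G ∎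
      where
      open ≤-Reasoning
      sup : Supported G c
      sup = run-supported σ (const 0) (λ e∈σ → ∈-copies⁻ N G (∈-resp-↭ σ↭ e∈σ)) (λ _ → inj₁ refl)
      one : ∀ v → bit (lookup S v) * (c v ∸ N) ≤ total (λ e → bit (incident v e) * (edgeCounter c e ∸ N)) G
      one v with sup v
      ... | inj₁ eq rewrite eq | 0∸n≡0 N | *-zeroʳ (bit (lookup S v)) = z≤n
      ... | inj₂ (e , e∈G , inc , le) = begin
        bit (lookup S v) * (c v ∸ N)               ≤⟨ *-monoˡ-≤ _ (bit≤1 (lookup S v)) ⟩
        1 * (c v ∸ N)                              ≤⟨ *-monoʳ-≤ 1 (∸-monoˡ-≤ N le) ⟩
        bit true * (edgeCounter c e ∸ N)           ≡⟨ cong (λ b → bit b * (edgeCounter c e ∸ N)) inc ⟨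
        bit (incident v e) * (edgeCounter c e ∸ N) ≤⟨ total-∈ (λ e → bit (incident v e) * (edgeCounter c e ∸ N)) e∈G ⟩
        total (λ e → bit (incident v e) * (edgeCounter c e ∸ N)) G ∎
      split : ∀ {n} (S : Fin n → Bool) (f : Fin n → ℕ) →
              ∑ (λ v → bit (S v) * f v) ≤ ∑ (λ v → bit (S v)) * N + ∑ (λ v → bit (S v) * (f v ∸ N))
      split {zero}  S f = z≤n
      split {suc n} S f = begin
        bit b * x + ∑ (λ v → bit (S (suc v)) * f (suc v))
          ≤⟨ +-mono-≤ (*-monoʳ-≤ (bit b) (m≤n+m∸n x N)) (split (S ∘ suc) (f ∘ suc)) ⟩
        bit b * (N + (x ∸ N)) + (∑ (λ v → bit (S (suc v))) * N + ∑ (λ v → bit (S (suc v)) * (f (suc v) ∸ N)))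
          ≡⟨ arith (bit b) N (x ∸ N) _ _ ⟩
        (bit b + ∑ (λ v → bit (S (suc v)))) * N + (bit b * (x ∸ N) + ∑ (λ v → bit (S (suc v)) * (f (suc v) ∸ N))) ∎
        where
        b = S zero
        x = f zero
        arith : ∀ b N y p q → b * (N + y) + (p * N + q) ≡ (b + p) * N + (b * y + q)
        arith = solve-∀
      main : card S * N + N * X ≤ card S * N + ∑ (λ v → bit (lookup S v) * (c v ∸ N))
      main = begin
        card S * N + N * X             ≡⟨ arith (card S) N X ⟩
        N * (card S + X)               ≤⟨ *-monoʳ-≤ N ex ⟩
        N * edgesIn S G                ≡⟨ drawn (bit ∘ inside S) ⟨
        edgesIn S σ                    ≤⟨ ≤-trans (m≤n+m _ _) (drawnInside≤sumOver S σ (const 0)) ⟩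
        sumOver S c                    ≤⟨ split (lookup S) c ⟩
        card S * N + ∑ (λ v → bit (lookup S v) * (c v ∸ N)) ∎
        where
        arith : ∀ k N X → k * N + N * X ≡ N * (k + X)
        arith = solve-∀

-- Fractions, averages and cuts

toℚᵘ-/ : ∀ i d .{{_ : NonZero d}} → toℚᵘ (i ℚ./ d) ℚᵘ.≃ (i ℚᵘ./ d)
toℚᵘ-/ i (suc d) = ℚ.toℚᵘ-fromℚᵘ (ℚᵘ.mkℚᵘ i d)

/-≤ : ∀ {a b p q} .{{_ : NonZero p}} .{{_ : NonZero q}} → a * q ≤ b * p → ℤ.+ a ℚ./ p ℚ.≤ ℤ.+ b ℚ./ q
/-≤ {a} {b} {suc p} {suc q} le = ℚ.toℚᵘ-cancel-≤ (begin
  toℚᵘ (ℤ.+ a ℚ./ suc p) ≃⟨ toℚᵘ-/ (ℤ.+ a) (suc p) ⟩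
  ℤ.+ a ℚᵘ./ suc p       ≤⟨ ℚᵘ.*≤* (subst₂ ℤ._≤_ (ℤ.pos-* a (suc q)) (ℤ.pos-* b (suc p)) (ℤ.+≤+ le)) ⟩
  ℤ.+ b ℚᵘ./ suc q       ≃⟨ toℚᵘ-/ (ℤ.+ b) (suc q) ⟨
  toℚᵘ (ℤ.+ b ℚ./ suc q) ∎)
  where open ℚᵘ.≤-Reasoning

/-+ : ∀ a b d .{{_ : NonZero d}} → (ℤ.+ a ℚ./ d) ℚ.+ (ℤ.+ b ℚ./ d) ≡ ℤ.+ (a + b) ℚ./ d
/-+ a b (suc d) = ℚ.toℚᵘ-injective (begin
  toℚᵘ ((ℤ.+ a ℚ./ suc d) ℚ.+ (ℤ.+ b ℚ./ suc d))        ≈⟨ ℚ.toℚᵘ-homo-+ (ℤ.+ a ℚ./ suc d) (ℤ.+ b ℚ./ suc d) ⟩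
  toℚᵘ (ℤ.+ a ℚ./ suc d) ℚᵘ.+ toℚᵘ (ℤ.+ b ℚ./ suc d)    ≈⟨ ℚᵘ.+-cong (toℚᵘ-/ (ℤ.+ a) (suc d)) (toℚᵘ-/ (ℤ.+ b) (suc d)) ⟩
  (ℤ.+ a ℚᵘ./ suc d) ℚᵘ.+ (ℤ.+ b ℚᵘ./ suc d)            ≈⟨ ℚᵘ.*≡* cross ⟩
  ℤ.+ (a + b) ℚᵘ./ suc d                              ≈⟨ toℚᵘ-/ (ℤ.+ (a + b)) (suc d) ⟨
  toℚᵘ (ℤ.+ (a + b) ℚ./ suc d)                        ∎)
  where
  open import Relation.Binary.Reasoning.Setoid ℚᵘ.≃-setoid
  D = ℤ.+ suc d
  cross : (ℤ.+ a ℤ.* D ℤ.+ ℤ.+ b ℤ.* D) ℤ.* D ≡ ℤ.+ (a + b) ℤ.* (D ℤ.* D)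
  cross = trans (cong (ℤ._* D) (sym (ℤ.*-distribʳ-+ D (ℤ.+ a) (ℤ.+ b)))) (ℤ.*-assoc (ℤ.+ (a + b)) D D)

/-* : ∀ a b p q .{{_ : NonZero p}} .{{_ : NonZero q}} .{{_ : NonZero (p * q)}} →
      (ℤ.+ a ℚ./ p) ℚ.* (ℤ.+ b ℚ./ q) ≡ ℤ.+ (a * b) ℚ./ (p * q)
/-* a b (suc p) (suc q) = ℚ.toℚᵘ-injective (begin
  toℚᵘ ((ℤ.+ a ℚ./ suc p) ℚ.* (ℤ.+ b ℚ./ suc q))      ≈⟨ ℚ.toℚᵘ-homo-* (ℤ.+ a ℚ./ suc p) (ℤ.+ b ℚ./ suc q) ⟩
  toℚᵘ (ℤ.+ a ℚ./ suc p) ℚᵘ.* toℚᵘ (ℤ.+ b ℚ./ suc q)  ≈⟨ ℚᵘ.*-cong (toℚᵘ-/ (ℤ.+ a) (suc p)) (toℚᵘ-/ (ℤ.+ b) (suc q)) ⟩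
  (ℤ.+ a ℚᵘ./ suc p) ℚᵘ.* (ℤ.+ b ℚᵘ./ suc q)          ≈⟨ ℚᵘ.*≡* (cong (ℤ._* ℤ.+ (suc p * suc q)) (sym (ℤ.pos-* a b))) ⟩
  ℤ.+ (a * b) ℚᵘ./ (suc p * suc q)                  ≈⟨ toℚᵘ-/ (ℤ.+ (a * b)) (suc p * suc q) ⟨
  toℚᵘ (ℤ.+ (a * b) ℚ./ (suc p * suc q))            ∎)
  where open import Relation.Binary.Reasoning.Setoid ℚᵘ.≃-setoid

sumℚ-lower : ∀ {a} {A : Set a} d .{{_ : NonZero d}} (g : A → ℕ) (f : A → ℚ) xs →
  (∀ x → x ∈ xs → ℤ.+ g x ℚ./ d ℚ.≤ f x) → ℤ.+ total g xs ℚ./ d ℚ.≤ sumℚ (map f xs)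
sumℚ-lower d g f []       g≤f = /-≤ {0} {0} {d} {1} z≤n
sumℚ-lower d g f (x ∷ xs) g≤f = begin
  ℤ.+ (g x + total g xs) ℚ./ d              ≡⟨ /-+ (g x) (total g xs) d ⟨
  (ℤ.+ g x ℚ./ d) ℚ.+ (ℤ.+ total g xs ℚ./ d)  ≤⟨ ℚ.+-mono-≤ (g≤f x (here refl)) (sumℚ-lower d g f xs λ y y∈ → g≤f y (there y∈)) ⟩
  f x ℚ.+ sumℚ (map f xs)                 ∎
  where open ℚ.≤-Reasoning

-- The transfer from natural numbers to rationals: once the values are bounded below by fractions
-- with a common denominator `d`, a bound on the mean is one cross-multiplied inequality. It serves
-- with `d = N` for the error and with `d = 1` for probabilities.
average-lower : ∀ {a} {A : Set a} d .{{_ : NonZero d}} (g : A → ℕ) (f : A → ℚ) xs → NonZero (length xs) →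
  (∀ x → x ∈ xs → ℤ.+ g x ℚ./ d ℚ.≤ f x) →
  ∀ {p q} .{{_ : NonZero q}} → p * (d * length xs) ≤ total g xs * q → ℤ.+ p ℚ./ q ℚ.≤ average xs f
average-lower (suc d) g f xs@(x ∷ xs′) _ g≤f {p} {q} le = begin
  ℤ.+ p ℚ./ q
    ≤⟨ /-≤ {p} {total g xs * 1} {q} {suc d * length xs} (≤-trans le (≤-reflexive (cong (_* q) (sym (*-identityʳ (total g xs)))))) ⟩
  ℤ.+ (total g xs * 1) ℚ./ (suc d * length xs)
    ≡⟨ /-* (total g xs) 1 (suc d) (length xs) ⟨
  (ℤ.+ total g xs ℚ./ suc d) ℚ.* (ℤ.+ 1 ℚ./ length xs)
    ≤⟨ ℚ.*-monoʳ-≤-nonNeg (ℤ.+ 1 ℚ./ length xs) {{ℚ.normalize-nonNeg 1 (length xs)}} (sumℚ-lower (suc d) g f xs g≤f) ⟩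
  average xs f ∎
  where open ℚ.≤-Reasoning

module _ (x : ℝ) where
  open ℝ x

  upper-closed-≤ : ∀ {q r} → q ℚ.≤ r → Upper q → Upper r
  upper-closed-≤ {q} {r} q≤r Uq with q ℚ.<? r
  ... | yes q<r = upper-closed q<r Uq
  ... | no q≮r  = subst Upper (ℚ.≤-antisym q≤r (ℚ.≮⇒≥ q≮r)) Uq

  lower<upper : ∀ {q r} → Lower q → Upper r → q ℚ.< r
  lower<upper {q} {r} Lq Ur with q ℚ.<? r
  ... | yes q<r = q<r
  ... | no q≮r  = contradiction (upper-closed-≤ (ℚ.≮⇒≥ q≮r) Ur) (disjoint Lq)

  ≤lower⇒≤ : ∀ {q r} → q ℚ.≤ r → Lower r → q ℚ≤ℝ x
  ≤lower⇒≤ q≤r Lr Uq = disjoint Lr (upper-closed-≤ q≤r Uq)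

  -- With q the denominator of a rational in (½ , x), the bound reads x ≥ ½ + 1/(2q).
  supercritical : ½ ℚ<ℝ x → ∃[ q ] (NonZero q ×
    (∀ m n .{{_ : NonZero n}} → x ℝ<ℚ ℤ.+ suc m ℚ./ n → suc q * n ≤ 2 * q * suc m))
  supercritical L½ with lower-open L½
  ... | r@(mkℚ (ℤ.+ p) d-1 _) , ½<r , Lr = suc d-1 , _ , bound
    where
    q = suc d-1
    q<p2 : q < p * 2
    q<p2 = ℤ.drop‿+<+ (subst₂ ℤ._<_ (trans (sym (ℤ.pos-* 1 q)) (cong ℤ.+_ (*-identityˡ q))) (sym (ℤ.pos-* p 2)) (ℚ.drop-*<* ½<r))
    bound : ∀ m n .{{_ : NonZero n}} → x ℝ<ℚ ℤ.+ suc m ℚ./ n → suc q * n ≤ 2 * q * suc m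
    bound m n@(suc n-1) Um with ℚ.toℚᵘ-mono-< (lower<upper Lr Um)
    ... | r<m with ℚᵘ.<-respʳ-≃ (toℚᵘ-/ (ℤ.+ suc m) n) r<m
    ... | ℚᵘ.*<* lt = begin
      suc q * n       ≤⟨ *-monoˡ-≤ n q<p2 ⟩
      p * 2 * n       ≡⟨ arith p n ⟩
      2 * (p * n)     ≤⟨ *-monoʳ-≤ 2 (<⇒≤ (ℤ.drop‿+<+ (subst₂ ℤ._<_ (sym (ℤ.pos-* p n)) (sym (ℤ.pos-* (suc m) q)) lt))) ⟩
      2 * (suc m * q) ≡⟨ arith′ q (suc m) ⟩
      2 * q * suc m   ∎
      where
      open ≤-Reasoning
      arith : ∀ p n → p * 2 * n ≡ 2 * (p * n)
      arith = solve-∀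
      arith′ : ∀ q m → 2 * (m * q) ≡ 2 * q * m
      arith′ = solve-∀
  ... | mkℚ ℤ.-[1+ _ ] d-1 _ , ℚ.*<* () , Lr

  -- A rational upper bound of `x` has denominator at least 1, so the absolute value of its
  -- numerator is a bound too.
  bounded : ∃[ B ] (∀ m n .{{_ : NonZero n}} → ℤ.+ m ℚ./ n ℚ≤ℝ x → m ≤ B * n)
  bounded with upper-inhabited
  ... | b@(mkℚ i d-1 _) , Ub = ℤ.∣ i ∣ , bound
    where
    bound : ∀ m n .{{_ : NonZero n}} → ℤ.+ m ℚ./ n ℚ≤ℝ x → m ≤ ℤ.∣ i ∣ * n
    bound m n@(suc n-1) m≤x with ℚᵘ.≤-respˡ-≃ (toℚᵘ-/ (ℤ.+ m) n) (ℚ.toℚᵘ-mono-≤ (ℚ.≮⇒≥ {b} {ℤ.+ m ℚ./ n} λ b<m → m≤x (upper-closed b<m Ub)))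
    ... | ℚᵘ.*≤* le = ≤-trans (m≤m*n m (suc d-1)) (ℤ.drop‿+≤+ (begin
      ℤ.+ (m * suc d-1)      ≡⟨ ℤ.pos-* m (suc d-1) ⟩
      ℤ.+ m ℤ.* ℤ.+ suc d-1    ≤⟨ le ⟩
      i ℤ.* ℤ.+ n            ≤⟨ ℤ.*-monoʳ-≤-nonNeg (ℤ.+ n) (i≤∣i∣ i) ⟩
      ℤ.+ ℤ.∣ i ∣ ℤ.* ℤ.+ n    ≡⟨ ℤ.pos-* ℤ.∣ i ∣ n ⟨
      ℤ.+ (ℤ.∣ i ∣ * n)      ∎))
      where
      open ℤ.≤-Reasoning
      i≤∣i∣ : ∀ i → i ℤ.≤ ℤ.+ ℤ.∣ i ∣
      i≤∣i∣ (ℤ.+ _)       = ℤ.≤-refl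
      i≤∣i∣ ℤ.-[1+ _ ] = ℤ.-≤+

  -- `suc E` is the denominator of a rational strictly between 0 and `x`. Its numerator is at least
  -- 1, so a failure probability of at most 1/(E + 1) is small enough.
  reciprocal-below : 0ℚ ℚ<ℝ x → ∃[ E ] (∀ p → ℤ.+ E ℚ./ suc E ℚ.≤ p → 1ℚ ℚ.- p ℚ≤ℝ x)
  reciprocal-below L0 with lower-open L0
  ... | r@(mkℚ (ℤ.+ suc a) E _) , _ , Lr = E , λ p E≤p → ≤lower⇒≤ (bound p E≤p) Lr
    where
    bound : ∀ p → ℤ.+ E ℚ./ suc E ℚ.≤ p → 1ℚ ℚ.- p ℚ.≤ r
    bound p E≤p = begin
      1ℚ ℚ.- p                                               ≤⟨ ℚ.+-monoʳ-≤ 1ℚ (ℚ.neg-antimono-≤ E≤p) ⟩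
      1ℚ ℚ.- ℤ.+ E ℚ./ suc E                                   ≤⟨ ℚ.+-monoˡ-≤ (ℚ.- (ℤ.+ E ℚ./ suc E)) one ⟩
      ((ℤ.+ 1 ℚ./ suc E) ℚ.+ (ℤ.+ E ℚ./ suc E)) ℚ.- ℤ.+ E ℚ./ suc E  ≡⟨ ℚ.+-assoc (ℤ.+ 1 ℚ./ suc E) (ℤ.+ E ℚ./ suc E) _ ⟩
      (ℤ.+ 1 ℚ./ suc E) ℚ.+ ((ℤ.+ E ℚ./ suc E) ℚ.- ℤ.+ E ℚ./ suc E)  ≡⟨ cong ((ℤ.+ 1 ℚ./ suc E) ℚ.+_) (ℚ.+-inverseʳ (ℤ.+ E ℚ./ suc E)) ⟩
      (ℤ.+ 1 ℚ./ suc E) ℚ.+ 0ℚ                                 ≡⟨ ℚ.+-identityʳ _ ⟩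
      ℤ.+ 1 ℚ./ suc E                                          ≤⟨ /-≤ {1} {suc a} {suc E} {suc E} (*-monoˡ-≤ (suc E) {1} {suc a} (s≤s z≤n)) ⟩
      ℤ.+ suc a ℚ./ suc E                                      ≡⟨ ℚ.fromℚᵘ-toℚᵘ r ⟩
      r                                                      ∎
      where
      open ℚ.≤-Reasoning
      one : 1ℚ ℚ.≤ (ℤ.+ 1 ℚ./ suc E) ℚ.+ (ℤ.+ E ℚ./ suc E)
      one = subst (1ℚ ℚ.≤_) (sym (/-+ 1 E (suc E))) (/-≤ {1} {suc E} {1} {suc E} (≤-reflexive (*-comm 1 (suc E))))
  ... | mkℚ (ℤ.+ zero) _ _      , ℚ.*<* (ℤ.+<+ ()) , _
  ... | mkℚ ℤ.-[1+ _ ] _ _   , ℚ.*<* () , _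

-- Sublists and bit strings

nC0≡1 : ∀ n → n C 0 ≡ 1
nC0≡1 zero    = refl
nC0≡1 (suc n) = refl

module _ {a} {A : Set a} where

  total-cong : ∀ {f g : A → ℕ} xs → (∀ x → f x ≡ g x) → total f xs ≡ total g xs
  total-cong xs f≗g = cong sum (map-cong f≗g xs)

  total-+ : ∀ (f g : A → ℕ) xs → total (λ x → f x + g x) xs ≡ total f xs + total g xs
  total-+ f g []       = refl
  total-+ f g (x ∷ xs) = trans (cong (f x + g x +_) (total-+ f g xs)) (interchange (f x) (g x) _ _)
    where
    interchange : ∀ a b c d → a + b + (c + d) ≡ a + c + (b + d)
    interchange = solve-∀

  total-* : ∀ k (f : A → ℕ) xs → total (λ x → k * f x) xs ≡ k * total f xs
  total-* k f []       = sym (*-zeroʳ k)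
  total-* k f (x ∷ xs) = trans (cong (k * f x +_) (total-* k f xs)) (sym (*-distribˡ-+ k (f x) _))

  total-1 : ∀ (xs : List A) → total (const 1) xs ≡ length xs
  total-1 []       = refl
  total-1 (x ∷ xs) = cong suc (total-1 xs)

module _ {a} {A : Set a} where

  -- The expectation of `φ` at a uniformly random m-element sublist, without the division by
  -- `length K C m`. All estimates about the random graph thus stay in ℕ.
  cnt : ℕ → List A → (List A → ℕ) → ℕ
  cnt m K φ = total φ (sublists m K)

  cnt-∷ : ∀ m x K φ → cnt (suc m) (x ∷ K) φ ≡ cnt m K (φ ∘ (x ∷_)) + cnt (suc m) K φ
  cnt-∷ m x K φ = trans (total-++ φ (map (x ∷_) (sublists m K)) _)
    (cong (λ ys → sum ys + cnt (suc m) K φ) (sym (map-∘ (sublists m K))))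

  -- The exploration decides as it goes which remaining pair comes next, so the pairs must be
  -- reorderable at will. For a swap of the first two entries, the sublists are split by which of
  -- the two they contain, and the two mixed classes trade places.
  cnt-↭ : ∀ m {K K′ φ} → K ↭ K′ → (∀ {G G′} → G ↭ G′ → φ G ≡ φ G′) → cnt m K φ ≡ cnt m K′ φ
  cnt-↭ zero          p φ-resp = refl
  cnt-↭ (suc m)       _↭_.refl φ-resp = refl
  cnt-↭ (suc m) {φ = φ} (_↭_.trans p q) φ-resp = trans (cnt-↭ (suc m) p φ-resp) (cnt-↭ (suc m) q φ-resp)
  cnt-↭ (suc m) {φ = φ} (prep {xs = K} {ys = K′} x p) φ-resp = begin
    cnt (suc m) (x ∷ K) φ                     ≡⟨ cnt-∷ m x K φ ⟩
    cnt m K (φ ∘ (x ∷_)) + cnt (suc m) K φ    ≡⟨ cong₂ _+_ (cnt-↭ m p (φ-resp ∘ prep x)) (cnt-↭ (suc m) p φ-resp) ⟩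
    cnt m K′ (φ ∘ (x ∷_)) + cnt (suc m) K′ φ  ≡⟨ cnt-∷ m x K′ φ ⟨
    cnt (suc m) (x ∷ K′) φ                    ∎
    where open ≡-Reasoning
  cnt-↭ (suc zero) {φ = φ} (swap {xs = K} {ys = K′} x y p) φ-resp = begin
    cnt 1 (x ∷ y ∷ K) φ                                    ≡⟨ cong (φ (x ∷ []) +_) (cong (φ (y ∷ []) +_) (cnt-↭ 1 p φ-resp)) ⟩
    φ (x ∷ []) + (φ (y ∷ []) + cnt 1 K′ φ)                 ≡⟨ rearrange (φ (x ∷ [])) (φ (y ∷ [])) _ ⟩
    φ (y ∷ []) + (φ (x ∷ []) + cnt 1 K′ φ)                 ∎
    where
    open ≡-Reasoning
    rearrange : ∀ a b c → a + (b + c) ≡ b + (a + c)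
    rearrange = solve-∀
  cnt-↭ (suc (suc m)) {φ = φ} (swap {xs = K} {ys = K′} x y p) φ-resp = begin
    cnt (2 + m) (x ∷ y ∷ K) φ
      ≡⟨ expand x y K ⟩
    cnt m K (φ ∘ (x ∷_) ∘ (y ∷_)) + cnt (1 + m) K (φ ∘ (x ∷_)) + (cnt (1 + m) K (φ ∘ (y ∷_)) + cnt (2 + m) K φ)
      ≡⟨ cong₂ _+_
           (cong₂ _+_ (trans (total-cong (sublists m K) λ G → φ-resp (swap x y ↭-refl)) (cnt-↭ m p (φ-resp ∘ prep y ∘ prep x)))
                      (cnt-↭ (1 + m) p (φ-resp ∘ prep x)))
           (cong₂ _+_ (cnt-↭ (1 + m) p (φ-resp ∘ prep y)) (cnt-↭ (2 + m) p φ-resp)) ⟩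
    cnt m K′ (φ ∘ (y ∷_) ∘ (x ∷_)) + cnt (1 + m) K′ (φ ∘ (x ∷_)) + (cnt (1 + m) K′ (φ ∘ (y ∷_)) + cnt (2 + m) K′ φ)
      ≡⟨ rearrange (cnt m K′ _) (cnt (1 + m) K′ (φ ∘ (x ∷_))) (cnt (1 + m) K′ (φ ∘ (y ∷_))) _ ⟩
    cnt m K′ (φ ∘ (y ∷_) ∘ (x ∷_)) + cnt (1 + m) K′ (φ ∘ (y ∷_)) + (cnt (1 + m) K′ (φ ∘ (x ∷_)) + cnt (2 + m) K′ φ)
      ≡⟨ expand y x K′ ⟨
    cnt (2 + m) (y ∷ x ∷ K′) φ ∎
    where
    open ≡-Reasoning
    rearrange : ∀ a b c d → a + b + (c + d) ≡ a + c + (b + d)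
    rearrange = solve-∀
    expand : ∀ x y K → cnt (2 + m) (x ∷ y ∷ K) φ ≡
      cnt m K (φ ∘ (x ∷_) ∘ (y ∷_)) + cnt (1 + m) K (φ ∘ (x ∷_)) + (cnt (1 + m) K (φ ∘ (y ∷_)) + cnt (2 + m) K φ)
    expand x y K = trans (cnt-∷ (1 + m) x (y ∷ K) φ) (cong₂ _+_ (cnt-∷ m y K _) (cnt-∷ (1 + m) y K φ))

  cnt-1 : ∀ m K → cnt m K (const 1) ≡ length K C m
  cnt-1 zero    K       = sym (nC0≡1 (length K))
  cnt-1 (suc m) []      = sym (k>n⇒nCk≡0 (s≤s (z≤n {m})))
  cnt-1 (suc m) (x ∷ K) = begin
    cnt (suc m) (x ∷ K) (const 1)               ≡⟨ cnt-∷ m x K _ ⟩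
    cnt m K (const 1) + cnt (suc m) K (const 1) ≡⟨ cong₂ _+_ (cnt-1 m K) (cnt-1 (suc m) K) ⟩
    length K C m + length K C suc m             ≡⟨ nCk+nC[k+1]≡[n+1]C[k+1] (length K) m ⟩
    length (x ∷ K) C suc m                      ∎
    where open ≡-Reasoning

-- Summation over the answer strings, of length `L` with `m` ones. The recursion on the first bit
-- has the shape of `cnt-∷`, which lets strings and sublists be compared one query at a time.
cntᵇ : ℕ → ℕ → (List Bool → ℕ) → ℕ
cntᵇ zero    zero    ψ = ψ []
cntᵇ zero    (suc m) ψ = 0
cntᵇ (suc L) zero    ψ = cntᵇ L zero (ψ ∘ (false ∷_))
cntᵇ (suc L) (suc m) ψ = cntᵇ L m (ψ ∘ (true ∷_)) + cntᵇ L (suc m) (ψ ∘ (false ∷_))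

cntᵇ-mono : ∀ L m {ψ ψ′} → (∀ s → length s ≡ L → ψ s ≤ ψ′ s) → cntᵇ L m ψ ≤ cntᵇ L m ψ′
cntᵇ-mono zero    zero    ψ≤ = ψ≤ [] refl
cntᵇ-mono zero    (suc m) ψ≤ = z≤n
cntᵇ-mono (suc L) zero    ψ≤ = cntᵇ-mono L zero λ s eq → ψ≤ (false ∷ s) (cong suc eq)
cntᵇ-mono (suc L) (suc m) ψ≤ = +-mono-≤
  (cntᵇ-mono L m λ s eq → ψ≤ (true ∷ s) (cong suc eq))
  (cntᵇ-mono L (suc m) λ s eq → ψ≤ (false ∷ s) (cong suc eq))

cntᵇ-+ : ∀ L m ψ ψ′ → cntᵇ L m (λ s → ψ s + ψ′ s) ≡ cntᵇ L m ψ + cntᵇ L m ψ′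
cntᵇ-+ zero    zero    ψ ψ′ = refl
cntᵇ-+ zero    (suc m) ψ ψ′ = refl
cntᵇ-+ (suc L) zero    ψ ψ′ = cntᵇ-+ L zero _ _
cntᵇ-+ (suc L) (suc m) ψ ψ′ =
  trans (cong₂ _+_ (cntᵇ-+ L m _ _) (cntᵇ-+ L (suc m) _ _))
    (interchange (cntᵇ L m (ψ ∘ (true ∷_))) _ _ _)
  where
  interchange : ∀ a b c d → a + b + (c + d) ≡ a + c + (b + d)
  interchange = solve-∀

module _ {a} {A : Set a} where

  select : List Bool → List A → List A
  select []          K       = []
  select (b ∷ s)     []      = []
  select (true ∷ s)  (x ∷ K) = x ∷ select s K
  select (false ∷ s) (x ∷ K) = select s K

  cnt-select : ∀ m K φ → cnt m K φ ≡ cntᵇ (length K) m (λ s → φ (select s K))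
  cnt-select zero    []      φ = +-identityʳ (φ [])
  cnt-select zero    (x ∷ K) φ = cnt-select zero K φ
  cnt-select (suc m) []      φ = refl
  cnt-select (suc m) (x ∷ K) φ = trans (cnt-∷ m x K φ) (cong₂ _+_ (cnt-select m K _) (cnt-select (suc m) K φ))

  -- The coupling in counting form. The quantifier over `m` belongs inside: a positive answer leaves
  -- one edge fewer to place among the remaining pairs, so the induction changes `m`.
  Dominates : List A → (List A → ℕ) → (List Bool → ℕ) → Set
  Dominates K φ ψ = ∀ m → cntᵇ (length K) m ψ ≤ cnt m K φ

  -- The answer to the first query is the first bit, whichever element is queried:
  -- the answers of an adaptive exploration are exchangeable.
  dominates-query : ∀ {x K φ ψ} →
    Dominates K (φ ∘ (x ∷_)) (ψ ∘ (true ∷_)) → Dominates K φ (ψ ∘ (false ∷_)) → Dominates (x ∷ K) φ ψ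
  dominates-query dom₁ dom₀ zero    = dom₀ zero
  dominates-query {x} {K} {φ} dom₁ dom₀ (suc m) =
    ≤-trans (+-mono-≤ (dom₁ m) (dom₀ (suc m))) (≤-reflexive (sym (cnt-∷ m x K φ)))

  dominates-↭ : ∀ {K K′ φ ψ} → K ↭ K′ → (∀ {G G′} → G ↭ G′ → φ G ≡ φ G′) →
    Dominates K′ φ ψ → Dominates K φ ψ
  dominates-↭ {φ = φ} {ψ} p φ-resp dom m rewrite ↭-length p | cnt-↭ m p φ-resp = dom m

  -- From here on the order of the queries is fixed: each bit decides about the entry of `K` at its
  -- own position, and a pointwise comparison suffices.
  dominates-select : ∀ {K φ ψ} → (∀ s → length s ≡ length K → ψ s ≤ φ (select s K)) → Dominates K φ ψ
  dominates-select {K} {φ} {ψ} ψ≤φ m = ≤-trans (cntᵇ-mono (length K) m ψ≤φ) (≤-reflexive (sym (cnt-select m K φ)))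

-- Moments of the hypergeometric distribution

-- Turns the binomial coefficients in the moments into multiples of `L C m`, which is how the mean m
-- A / L appears.
absorption : ∀ n k → suc k * (suc n C suc k) ≡ suc n * (n C k)
absorption n zero = begin
  1 * (suc n C 1)  ≡⟨ *-identityˡ _ ⟩
  suc n C 1        ≡⟨ nC1≡n (suc n) ⟩
  suc n            ≡⟨ *-identityʳ (suc n) ⟨
  suc n * 1        ≡⟨ cong (suc n *_) (sym (nC0≡1 n)) ⟩
  suc n * (n C 0)  ∎
  where
  open ≡-Reasoning
absorption zero (suc k) = begin
  (2 + k) * (1 C (2 + k)) ≡⟨ cong ((2 + k) *_) (k>n⇒nCk≡0 {1} {2 + k} (s≤s (s≤s z≤n))) ⟩
  (2 + k) * 0             ≡⟨ *-zeroʳ (2 + k) ⟩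
  0                       ≡⟨ cong (1 *_) (k>n⇒nCk≡0 {0} {1 + k} (s≤s z≤n)) ⟨
  1 * (0 C suc k)         ∎
  where open ≡-Reasoning
absorption (suc n) (suc k) = begin
  (2 + k) * ((2 + n) C (2 + k))
    ≡⟨ cong ((2 + k) *_) (nCk+nC[k+1]≡[n+1]C[k+1] (suc n) (suc k)) ⟨
  (2 + k) * (p + (suc n C (2 + k)))
    ≡⟨ arith k p (suc n C (2 + k)) ⟩
  p + (suc k * p + (2 + k) * (suc n C (2 + k)))
    ≡⟨ cong (p +_) (cong₂ _+_ (absorption n k) (absorption n (suc k))) ⟩
  p + (suc n * (n C k) + suc n * (n C suc k))
    ≡⟨ cong (p +_) (*-distribˡ-+ (suc n) (n C k) (n C suc k)) ⟨
  p + suc n * (n C k + n C suc k)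
    ≡⟨ cong (λ z → p + suc n * z) (nCk+nC[k+1]≡[n+1]C[k+1] n k) ⟩
  (2 + n) * p ∎
  where
  open ≡-Reasoning
  p = suc n C suc k
  arith : ∀ k p q → (2 + k) * (p + q) ≡ p + (suc k * p + (2 + k) * q)
  arith = solve-∀

nCk>0 : ∀ {n k} → k ≤ n → 0 < n C k
nCk>0 {zero}  {zero}  z≤n = ≤-refl
nCk>0 {suc n} {zero}  z≤n = ≤-refl
nCk>0 {suc n} {suc k} (s≤s k≤n) =
  ≤-trans (nCk>0 k≤n) (≤-trans (m≤m+n _ _) (≤-reflexive (nCk+nC[k+1]≡[n+1]C[k+1] n k)))

ones : List Bool → ℕ
ones = total bit

-- The factorial moment Y (Y - 1). It counts ordered pairs of distinct ones, each of which lies in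
-- the same number of sublists.
falling₂ : ℕ → ℕ
falling₂ x = x * pred x

falling₂-+ : ∀ b x → falling₂ (bit b + x) ≡ falling₂ x + 2 * bit b * x
falling₂-+ false x       = sym (+-identityʳ (falling₂ x))
falling₂-+ true  zero    = refl
falling₂-+ true  (suc x) = arith x
  where
  arith : ∀ x → (2 + x) * (1 + x) ≡ (1 + x) * x + 2 * 1 * (1 + x)
  arith = solve-∀

mutual
  first-moment : ∀ j b T → cnt (suc j) (b ∷ T) ones ≡ ones (b ∷ T) * (length T C j)
  first-moment j b T = begin
    cnt (suc j) (b ∷ T) ones
      ≡⟨ cnt-∷ j b T ones ⟩
    total (λ G → bit b + ones G) (sublists j T) + cnt (suc j) T ones
      ≡⟨ cong (_+ cnt (suc j) T ones) (total-+ (const (bit b)) ones (sublists j T)) ⟩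
    total (const (bit b)) (sublists j T) + cnt j T ones + cnt (suc j) T ones
      ≡⟨ +-assoc (total (const (bit b)) (sublists j T)) (cnt j T ones) (cnt (suc j) T ones) ⟩
    total (const (bit b)) (sublists j T) + (cnt j T ones + cnt (suc j) T ones)
      ≡⟨ cong₂ _+_ constant (first-moment′ j T) ⟩
    bit b * (length T C j) + ones T * (length T C j)
      ≡⟨ *-distribʳ-+ (length T C j) (bit b) (ones T) ⟨
    ones (b ∷ T) * (length T C j) ∎
    where
    open ≡-Reasoning
    constant : total (const (bit b)) (sublists j T) ≡ bit b * (length T C j)
    constant = begin
      total (const (bit b)) (sublists j T)     ≡⟨ total-cong (sublists j T) (λ _ → sym (*-identityʳ (bit b))) ⟩
      total (λ _ → bit b * 1) (sublists j T)   ≡⟨ total-* (bit b) (const 1) (sublists j T) ⟩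
      bit b * cnt j T (const 1)                ≡⟨ cong (bit b *_) (cnt-1 j T) ⟩
      bit b * (length T C j)                   ∎

  -- Splitting off the head of a list leaves sublists of two consecutive sizes. Their joint count
  -- has a closed form by Pascal's rule, and it is this form that the recursion consumes.
  first-moment′ : ∀ j T → cnt j T ones + cnt (suc j) T ones ≡ ones T * (length T C j)
  first-moment′ zero    []      = refl
  first-moment′ (suc j) []      = refl
  first-moment′ zero    (b ∷ T) = trans (first-moment 0 b T) (cong (ones (b ∷ T) *_) (nC0≡1 (length T)))
  first-moment′ (suc j) (b ∷ T) = begin
    cnt (suc j) (b ∷ T) ones + cnt (2 + j) (b ∷ T) ones
      ≡⟨ cong₂ _+_ (first-moment j b T) (first-moment (suc j) b T) ⟩
    ones (b ∷ T) * (length T C j) + ones (b ∷ T) * (length T C suc j)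
      ≡⟨ *-distribˡ-+ (ones (b ∷ T)) (length T C j) _ ⟨
    ones (b ∷ T) * (length T C j + length T C suc j)
      ≡⟨ cong (ones (b ∷ T) *_) (nCk+nC[k+1]≡[n+1]C[k+1] (length T) j) ⟩
    ones (b ∷ T) * (length (b ∷ T) C suc j) ∎
    where open ≡-Reasoning

falling₂-single : ∀ T → cnt 1 T (falling₂ ∘ ones) ≡ 0
falling₂-single []          = refl
falling₂-single (true ∷ T)  = falling₂-single T
falling₂-single (false ∷ T) = falling₂-single T

mutual
  -- Every ordered pair of distinct ones lies in `length T C j` sublists. The recursion splits off
  -- `a`: pairs that involve `a` are counted by the first moment of the rest.
  second-moment : ∀ j a b T → cnt (2 + j) (a ∷ b ∷ T) (falling₂ ∘ ones) ≡ falling₂ (ones (a ∷ b ∷ T)) * (length T C j)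
  second-moment j a b T = begin
    cnt (2 + j) (a ∷ bT) F
      ≡⟨ cnt-∷ (suc j) a bT F ⟩
    total (λ G → falling₂ (bit a + ones G)) (sublists (suc j) bT) + cnt (2 + j) bT F
      ≡⟨ cong (_+ cnt (2 + j) bT F) (total-cong (sublists (suc j) bT) (falling₂-+ a ∘ ones)) ⟩
    total (λ G → F G + 2 * bit a * ones G) (sublists (suc j) bT) + cnt (2 + j) bT F
      ≡⟨ cong (_+ cnt (2 + j) bT F) (total-+ F (λ G → 2 * bit a * ones G) (sublists (suc j) bT)) ⟩
    cnt (suc j) bT F + total (λ G → 2 * bit a * ones G) (sublists (suc j) bT) + cnt (2 + j) bT F
      ≡⟨ cong (λ z → cnt (suc j) bT F + z + cnt (2 + j) bT F) (total-* (2 * bit a) ones (sublists (suc j) bT)) ⟩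
    cnt (suc j) bT F + 2 * bit a * cnt (suc j) bT ones + cnt (2 + j) bT F
      ≡⟨ rearrange (cnt (suc j) bT F) _ _ ⟩
    cnt (suc j) bT F + cnt (2 + j) bT F + 2 * bit a * cnt (suc j) bT ones
      ≡⟨ cong₂ _+_ (second-moment′ j b T) (cong (2 * bit a *_) (first-moment j b T)) ⟩
    falling₂ (ones bT) * (length T C j) + 2 * bit a * (ones bT * (length T C j))
      ≡⟨ collect (falling₂ (ones bT)) (2 * bit a) (ones bT) (length T C j) ⟩
    (falling₂ (ones bT) + 2 * bit a * ones bT) * (length T C j)
      ≡⟨ cong (_* (length T C j)) (falling₂-+ a (ones bT)) ⟨
    falling₂ (ones (a ∷ bT)) * (length T C j) ∎
    where
    open ≡-Reasoning
    bT = b ∷ T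
    F = falling₂ ∘ ones
    rearrange : ∀ p q r → p + q + r ≡ p + r + q
    rearrange = solve-∀
    collect : ∀ f d x c → f * c + d * (x * c) ≡ (f + d * x) * c
    collect = solve-∀

  second-moment′ : ∀ j b T →
    cnt (suc j) (b ∷ T) (falling₂ ∘ ones) + cnt (2 + j) (b ∷ T) (falling₂ ∘ ones) ≡ falling₂ (ones (b ∷ T)) * (length T C j)
  second-moment′ zero    true  []      = refl
  second-moment′ zero    false []      = refl
  second-moment′ (suc j) true  []      = refl
  second-moment′ (suc j) false []      = refl
  second-moment′ zero    a (b ∷ T) = begin
    cnt 1 (a ∷ b ∷ T) F + cnt 2 (a ∷ b ∷ T) F      ≡⟨ cong (_+ cnt 2 (a ∷ b ∷ T) F) (falling₂-single (a ∷ b ∷ T)) ⟩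
    cnt 2 (a ∷ b ∷ T) F                            ≡⟨ second-moment 0 a b T ⟩
    falling₂ (ones (a ∷ b ∷ T)) * (length T C 0)   ≡⟨ cong (falling₂ (ones (a ∷ b ∷ T)) *_) (nC0≡1 (length T)) ⟩
    falling₂ (ones (a ∷ b ∷ T)) * (length (b ∷ T) C 0) ∎
    where
    open ≡-Reasoning
    F = falling₂ ∘ ones
  second-moment′ (suc j) a (b ∷ T) = begin
    cnt (2 + j) (a ∷ b ∷ T) F + cnt (3 + j) (a ∷ b ∷ T) F
      ≡⟨ cong₂ _+_ (second-moment j a b T) (second-moment (suc j) a b T) ⟩
    f * (length T C j) + f * (length T C suc j)
      ≡⟨ *-distribˡ-+ f (length T C j) _ ⟨
    f * (length T C j + length T C suc j)
      ≡⟨ cong (f *_) (nCk+nC[k+1]≡[n+1]C[k+1] (length T) j) ⟩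
    f * (length (b ∷ T) C suc j) ∎
    where
    open ≡-Reasoning
    F = falling₂ ∘ ones
    f = falling₂ (ones (a ∷ b ∷ T))

ones≤length : ∀ T → ones T ≤ length T
ones≤length []      = z≤n
ones≤length (b ∷ T) = +-mono-≤ (bit≤1 b) (ones≤length T)

-- This is D² ≤ (p - q)², written without subtraction.
square-deviation : ∀ {p q D} → D + q ≤ p → D * D + 2 * (p * q) ≤ q * q + p * p
square-deviation {p} {q} {D} le with m≤n⇒∃[o]m+o≡n le
... | k , refl = begin
  D * D + 2 * ((D + q + k) * q)                          ≤⟨ m≤m+n _ (2 * (D * k) + k * k) ⟩
  D * D + 2 * ((D + q + k) * q) + (2 * (D * k) + k * k)  ≡⟨ arith D q k ⟩
  q * q + (D + q + k) * (D + q + k)                      ∎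
  where
  open ≤-Reasoning
  arith : ∀ D q k → D * D + 2 * ((D + q + k) * q) + (2 * (D * k) + k * k) ≡ q * q + (D + q + k) * (D + q + k)
  arith = solve-∀

2pq≤p²+q² : ∀ p q → 2 * (p * q) ≤ q * q + p * p
2pq≤p²+q² p q with ≤-total p q
... | inj₁ p≤q = ≤-trans (≤-reflexive (arith p q)) (≤-trans (square-deviation {q} {p} {0} p≤q) (≤-reflexive (+-comm (p * p) (q * q))))
  where
  arith : ∀ p q → 2 * (p * q) ≡ 2 * (q * p)
  arith = solve-∀
... | inj₂ q≤p = square-deviation {p} {q} {0} q≤p

-- The number of ones in a uniformly random m-element sublist of T′ has mean m A / L.
chebyshev : ∀ j a b T x D →
  let T′ = a ∷ b ∷ T; L = length T′; A = ones T′; m = 2 + j in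
  D + L * x ≤ m * A →
  D * D * cnt m T′ (λ G → bit (does (ones G <? x))) ≤ L * (m * A) * (L C m)
chebyshev j a b T x D le =
  +-cancelʳ-≤ (2 * (p * p * N)) _ _ (begin
    D * D * Bad + 2 * (p * p * N)                  ≡⟨ cong (D * D * Bad +_) (arith₁ p N) ⟩
    D * D * Bad + 2 * p * (p * N)                  ≡⟨ cong (λ z → D * D * Bad + 2 * p * z) LS₁ ⟨
    D * D * Bad + 2 * p * (L * S₁)                 ≤⟨ summed ⟩
    L * L * (S₂ + S₁) + p * p * N                  ≡⟨ arith₂ L S₂ S₁ (p * p * N) ⟩
    L * (L * S₁) + (L * L * S₂ + p * p * N)        ≤⟨ +-mono-≤ (≤-reflexive (cong (L *_) LS₁)) (+-monoˡ-≤ (p * p * N) L²S₂) ⟩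
    L * (p * N) + (p * p * N + p * p * N)          ≡⟨ arith₃ L p N ⟩
    L * p * N + 2 * (p * p * N)                    ∎)
  where
  open ≤-Reasoning
  T′ = a ∷ b ∷ T
  l = length T
  L = length T′
  A = ones T′
  m = 2 + j
  p = m * A
  N = L C m
  Ks = sublists m T′
  bad = λ G → bit (does (ones G <? x))
  Bad = cnt m T′ bad
  S₁ = cnt m T′ ones
  S₂ = cnt m T′ (falling₂ ∘ ones)
  arith₁ : ∀ p N → 2 * (p * p * N) ≡ 2 * p * (p * N)
  arith₁ = solve-∀
  arith₂ : ∀ L S₂ S₁ r → L * L * (S₂ + S₁) + r ≡ L * (L * S₁) + (L * L * S₂ + r)
  arith₂ = solve-∀
  arith₃ : ∀ L p N → L * (p * N) + (p * p * N + p * p * N) ≡ L * p * N + 2 * (p * p * N)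
  arith₃ = solve-∀
  LS₁ : L * S₁ ≡ p * N
  LS₁ = begin-equality
    L * S₁                         ≡⟨ cong (L *_) (first-moment (suc j) a (b ∷ T)) ⟩
    L * (A * (suc l C suc j))      ≡⟨ s₁ L A (suc l C suc j) ⟩
    A * (L * (suc l C suc j))      ≡⟨ cong (A *_) (absorption (suc l) (suc j)) ⟨
    A * (m * N)                    ≡⟨ s₂ A m N ⟩
    p * N                          ∎
    where
    s₁ : ∀ L A c → L * (A * c) ≡ A * (L * c)
    s₁ = solve-∀
    s₂ : ∀ A m N → A * (m * N) ≡ m * A * N
    s₂ = solve-∀
  [L-1]LS₂ : suc l * (L * S₂) ≡ falling₂ A * (suc j * (m * N))
  [L-1]LS₂ = begin-equality
    suc l * (L * S₂)                              ≡⟨ cong (λ z → suc l * (L * z)) (second-moment j a b T) ⟩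
    suc l * (L * (falling₂ A * (l C j)))          ≡⟨ s₁ (suc l) L (falling₂ A) (l C j) ⟩
    falling₂ A * (L * (suc l * (l C j)))          ≡⟨ cong (λ z → falling₂ A * (L * z)) (absorption l j) ⟨
    falling₂ A * (L * (suc j * (suc l C suc j)))  ≡⟨ s₂ (falling₂ A) L (suc j) (suc l C suc j) ⟩
    falling₂ A * (suc j * (L * (suc l C suc j)))  ≡⟨ cong (λ z → falling₂ A * (suc j * z)) (absorption (suc l) (suc j)) ⟨
    falling₂ A * (suc j * (m * N))                ∎
    where
    s₁ : ∀ k L f c → k * (L * (f * c)) ≡ f * (L * (k * c))
    s₁ = solve-∀
    s₂ : ∀ f L k c → f * (L * (k * c)) ≡ f * (k * (L * c))
    s₂ = solve-∀
  -- That is (A - 1)/(L - 1) ≤ A/L. Sampling without replacement is negatively correlated, so the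
  -- second factorial moment is at most the square of the mean and the variance at most the mean.
  L*pred≤ : ∀ A → A ≤ L → L * pred A ≤ suc l * A
  L*pred≤ zero    _       = ≤-reflexive (trans (*-zeroʳ L) (sym (*-zeroʳ (suc l))))
  L*pred≤ (suc A) (s≤s A≤) = begin
    A + suc l * A        ≤⟨ +-monoˡ-≤ (suc l * A) A≤ ⟩
    suc l + suc l * A    ≡⟨ *-suc (suc l) A ⟨
    suc l * suc A        ∎
  L²S₂ : L * L * S₂ ≤ p * p * N
  L²S₂ = *-cancelˡ-≤ (suc l) (begin
    suc l * (L * L * S₂)                     ≡⟨ s₁ (suc l) L S₂ ⟩
    L * (suc l * (L * S₂))                   ≡⟨ cong (L *_) [L-1]LS₂ ⟩
    L * (A * pred A * (suc j * (m * N)))     ≡⟨ s₂ L A (pred A) (suc j) (m * N) ⟩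
    L * pred A * (A * (suc j * (m * N)))     ≤⟨ *-mono-≤ (L*pred≤ A (ones≤length T′)) (*-monoʳ-≤ A (*-monoˡ-≤ (m * N) (n≤1+n (suc j)))) ⟩
    suc l * A * (A * (m * (m * N)))          ≡⟨ s₃ (suc l) A m N ⟩
    suc l * (p * p * N)                      ∎)
    where
    s₁ : ∀ k L S → k * (L * L * S) ≡ L * (k * (L * S))
    s₁ = solve-∀
    s₂ : ∀ L A A′ k M → L * (A * A′ * (k * M)) ≡ L * A′ * (A * (k * M))
    s₂ = solve-∀
    s₃ : ∀ k A m N → k * A * (A * (m * (m * N))) ≡ k * (m * A * (m * A) * N)
    s₃ = solve-∀
  -- Markov's inequality for the squared deviation: D² times the indicator is at most (L · `ones G`
  -- - p)², with the mixed term moved to the left.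
  pointwise : ∀ G → D * D * bad G + 2 * p * (L * ones G) ≤ L * L * (falling₂ (ones G) + ones G) + p * p * 1
  pointwise G = begin
    D * D * bad G + 2 * p * (L * ones G)              ≡⟨ cong (D * D * bad G +_) (*-assoc 2 p (L * ones G)) ⟩
    D * D * bad G + 2 * (p * (L * ones G))            ≤⟨ cases (ones G <? x) ⟩
    L * ones G * (L * ones G) + p * p                 ≡⟨ square (ones G) p ⟩
    L * L * (falling₂ (ones G) + ones G) + p * p * 1  ∎
    where
    square : ∀ y p → L * y * (L * y) + p * p ≡ L * L * (falling₂ y + y) + p * p * 1
    square zero    p = s L p
      where
      s : ∀ L p → L * 0 * (L * 0) + p * p ≡ L * L * (0 + 0) + p * p * 1
      s = solve-∀
    square (suc y) p = s L y p
      where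
      s : ∀ L y p → L * (1 + y) * (L * (1 + y)) + p * p ≡ L * L * ((1 + y) * y + (1 + y)) + p * p * 1
      s = solve-∀
    cases : (d : Dec (ones G < x)) →
      D * D * bit (does d) + 2 * (p * (L * ones G)) ≤ L * ones G * (L * ones G) + p * p
    cases (yes y<x) rewrite *-identityʳ (D * D) =
      square-deviation {p} {L * ones G} {D} (≤-trans (+-monoʳ-≤ D (*-monoʳ-≤ L (<⇒≤ y<x))) le)
    cases (no _) rewrite *-zeroʳ (D * D) = 2pq≤p²+q² p (L * ones G)
  summed : D * D * Bad + 2 * p * (L * S₁) ≤ L * L * (S₂ + S₁) + p * p * N
  summed = begin
    D * D * Bad + 2 * p * (L * S₁)
      ≡⟨ cong₂ _+_ (total-* (D * D) bad Ks) (trans (total-* (2 * p) (λ G → L * ones G) Ks) (cong (2 * p *_) (total-* L ones Ks))) ⟨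
    total (λ G → D * D * bad G) Ks + total (λ G → 2 * p * (L * ones G)) Ks
      ≡⟨ total-+ (λ G → D * D * bad G) _ Ks ⟨
    total (λ G → D * D * bad G + 2 * p * (L * ones G)) Ks
      ≤⟨ total-mono Ks (λ G _ → pointwise G) ⟩
    total (λ G → L * L * (falling₂ (ones G) + ones G) + p * p * 1) Ks
      ≡⟨ total-+ (λ G → L * L * (falling₂ (ones G) + ones G)) _ Ks ⟩
    total (λ G → L * L * (falling₂ (ones G) + ones G)) Ks + total (λ _ → p * p * 1) Ks
      ≡⟨ cong₂ _+_ (trans (total-* (L * L) (λ G → falling₂ (ones G) + ones G) Ks) (cong (L * L *_) (total-+ (falling₂ ∘ ones) ones Ks)))
                   (trans (total-* (p * p) (const 1) Ks) (cong (p * p *_) (cnt-1 m T′))) ⟩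
    L * L * (S₂ + S₁) + p * p * N ∎

-- Exploration of the random graph

tri : ℕ → ℕ
tri zero    = 0
tri (suc y) = y + tri y

tri-mono : ∀ {y z} → y ≤ z → tri y ≤ tri z
tri-mono z≤n       = z≤n
tri-mono (s≤s y≤z) = +-mono-≤ y≤z (tri-mono y≤z)

2tri : ∀ y → 2 * tri y + y ≡ y * y
2tri zero    = refl
2tri (suc y) = trans (arith y (tri y)) (trans (cong (1 + 2 * y +_) (2tri y)) (arith′ y))
  where
  arith : ∀ y t → 2 * (y + t) + suc y ≡ 1 + 2 * y + (2 * t + y)
  arith = solve-∀
  arith′ : ∀ y → 1 + 2 * y + y * y ≡ suc y * suc y
  arith′ = solve-∀

card-insert : ∀ {n} (W : Subset n) v → ∑ (λ u → bit (lookup (W [ v ]≔ true) u)) ≤ suc (∑ (λ u → bit (lookup W u)))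
card-insert (b ∷ W) zero    = s≤s (m≤n+m _ (bit b))
card-insert (b ∷ W) (suc v) = ≤-trans (+-monoʳ-≤ (bit b) (card-insert W v)) (≤-reflexive (+-suc (bit b) _))

module _ {n : ℕ} where

  edge : Fin n → Fin n → Edge n
  edge u v = if does (u Fin.<? v) then (u , v) else (v , u)

  edge-comm : ∀ u v → edge u v ≡ edge v u
  edge-comm u v with Fin.<-cmp u v
  ... | tri< u<v _ v≮u rewrite dec-true (u Fin.<? v) u<v | dec-false (v Fin.<? u) v≮u = refl
  ... | tri≈ _ refl _ = refl
  ... | tri> u≮v _ v<u rewrite dec-false (u Fin.<? v) u≮v | dec-true (v Fin.<? u) v<u = refl

  pairs : List (Fin n) → Graph n
  pairs []       = []
  pairs (v ∷ vs) = map (edge v) vs ++ pairs vs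

  pairs-↭ : ∀ {us vs} → us ↭ vs → pairs us ↭ pairs vs
  pairs-↭ _↭_.refl    = ↭-refl
  pairs-↭ (_↭_.trans p q) = ↭-trans (pairs-↭ p) (pairs-↭ q)
  pairs-↭ (prep v p)  = ++⁺ (map⁺ (edge v) p) (pairs-↭ p)
  pairs-↭ (swap {xs = us} {ys = vs} u v p) rewrite edge-comm u v = prep _ (begin
    map (edge u) us ++ map (edge v) us ++ pairs us ↭⟨ ++⁺ (map⁺ (edge u) p) (++⁺ (map⁺ (edge v) p) (pairs-↭ p)) ⟩
    map (edge u) vs ++ map (edge v) vs ++ pairs vs ↭⟨ shifts (map (edge u) vs) (map (edge v) vs) ⟩
    map (edge v) vs ++ map (edge u) vs ++ pairs vs ∎)
    where open PermutationReasoning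

  -- `J` collects the pairs with an end in `vs`; it stays unspecified because only the pairs inside
  -- `us` are used later.
  pairs-++ : ∀ us vs → ∃[ J ] (pairs (us ++ vs) ↭ J ++ pairs us)
  pairs-++ []       vs = pairs vs , ↭-reflexive (sym (++-identityʳ (pairs vs)))
  pairs-++ (u ∷ us) vs with pairs-++ us vs
  ... | J , p = map (edge u) vs ++ J , (begin
    map (edge u) (us ++ vs) ++ pairs (us ++ vs)               ≡⟨ cong (_++ pairs (us ++ vs)) (map-++ (edge u) us vs) ⟩
    (map (edge u) us ++ map (edge u) vs) ++ pairs (us ++ vs)  ↭⟨ ++⁺ (++-comm (map (edge u) us) (map (edge u) vs)) p ⟩
    (map (edge u) vs ++ map (edge u) us) ++ J ++ pairs us     ↭⟨ ↭-assoc (map (edge u) vs) (map (edge u) us) _ ⟩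
    map (edge u) vs ++ map (edge u) us ++ J ++ pairs us       ↭⟨ ++⁺ˡ (map (edge u) vs) (shifts (map (edge u) us) J) ⟩
    map (edge u) vs ++ J ++ map (edge u) us ++ pairs us       ↭⟨ ↭-assoc (map (edge u) vs) J _ ⟨
    (map (edge u) vs ++ J) ++ pairs (u ∷ us)                  ∎)
    where open PermutationReasoning

  private
    increasing? : (e : Edge n) → Dec (proj₁ e Fin.< proj₂ e)
    increasing? e = proj₁ e Fin.<? proj₂ e

    increasing : List (Edge n) → List (Edge n)
    increasing = filter increasing?

  cartesianProduct-∷ʳ : ∀ (us : List (Fin n)) (v : Fin n) (vs : List (Fin n)) →
    cartesianProduct us (v ∷ vs) ↭ map (_, v) us ++ cartesianProduct us vs
  cartesianProduct-∷ʳ []       v vs = ↭-refl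
  cartesianProduct-∷ʳ (u ∷ us) v vs = prep (u , v) (begin
    map (u ,_) vs ++ cartesianProduct us (v ∷ vs)                  ↭⟨ ++⁺ˡ (map (u ,_) vs) (cartesianProduct-∷ʳ us v vs) ⟩
    map (u ,_) vs ++ map (_, v) us ++ cartesianProduct us vs       ↭⟨ shifts (map (u ,_) vs) (map (_, v) us) ⟩
    map (_, v) us ++ map (u ,_) vs ++ cartesianProduct us vs       ∎)
    where open PermutationReasoning

  increasing-star : ∀ u vs → All (u ≢_) vs →
    increasing (map (u ,_) vs) ++ increasing (map (_, u) vs) ↭ map (edge u) vs
  increasing-star u []       []         = ↭-refl
  increasing-star u (v ∷ vs) (u≢v ∷ u∉) with Fin.<-cmp u v
  ... | tri≈ _ u≡v _ = contradiction u≡v u≢v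
  ... | tri< u<v _ v≮u rewrite dec-true (u Fin.<? v) u<v | dec-false (v Fin.<? u) v≮u =
    prep (u , v) (increasing-star u vs u∉)
  ... | tri> u≮v _ v<u rewrite dec-false (u Fin.<? v) u≮v | dec-true (v Fin.<? u) v<u =
    ↭-trans (shift (v , u) (increasing (map (u ,_) vs)) _) (prep (v , u) (increasing-star u vs u∉))

  -- The product contains each unordered pair of distinct vertices in both orders, and the filter
  -- keeps one of them. So the two stars at `v`, with `v` as first and as second entry, merge into
  -- the single star in `pairs`; the diagonal entry is filtered out.
  increasing-product : ∀ vs → Unique vs → increasing (cartesianProduct vs vs) ↭ pairs vs
  increasing-product []       []        = ↭-refl
  increasing-product (v ∷ vs) (v∉ ∷ vs!) rewrite dec-false (v Fin.<? v) (Fin.<-irrefl refl) = begin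
    increasing (map (v ,_) vs ++ cartesianProduct vs (v ∷ vs))
      ≡⟨ filter-++ increasing? (map (v ,_) vs) _ ⟩
    increasing (map (v ,_) vs) ++ increasing (cartesianProduct vs (v ∷ vs))
      ↭⟨ ++⁺ˡ (increasing (map (v ,_) vs)) (filter-↭ increasing? (cartesianProduct-∷ʳ vs v vs)) ⟩
    increasing (map (v ,_) vs) ++ increasing (map (_, v) vs ++ cartesianProduct vs vs)
      ≡⟨ cong (increasing (map (v ,_) vs) ++_) (filter-++ increasing? (map (_, v) vs) _) ⟩
    increasing (map (v ,_) vs) ++ increasing (map (_, v) vs) ++ increasing (cartesianProduct vs vs)
      ↭⟨ ↭-assoc (increasing (map (v ,_) vs)) (increasing (map (_, v) vs)) _ ⟨
    (increasing (map (v ,_) vs) ++ increasing (map (_, v) vs)) ++ increasing (cartesianProduct vs vs)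
      ↭⟨ ++⁺ (increasing-star v vs v∉) (increasing-product vs vs!) ⟩
    pairs (v ∷ vs) ∎
    where open PermutationReasoning

  completeGraph-↭ : completeGraph n ↭ pairs (allFin n)
  completeGraph-↭ = increasing-product (allFin n) (allFin⁺ n)

  length-pairs : ∀ vs → length (pairs vs) ≡ tri (length vs)
  length-pairs []       = refl
  length-pairs (v ∷ vs) = trans (length-++ (map (edge v) vs)) (cong₂ _+_ (length-map (edge v) vs) (length-pairs vs))

  length-completeGraph : length (completeGraph n) ≡ tri n
  length-completeGraph = trans (↭-length completeGraph-↭)
    (trans (length-pairs (allFin n)) (cong tri (length-tabulate {n = n} (λ i → i))))

  insert-⊇ : ∀ (W : Subset n) v u → lookup W u ≡ true → lookup (W [ v ]≔ true) u ≡ true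
  insert-⊇ W v u Wu with u ≟ v
  ... | yes refl = lookup∘update v W true
  ... | no u≢v   = trans (lookup∘update′ u≢v W true) Wu

  inside-⊆ : ∀ {W W′ : Subset n} → (∀ u → lookup W u ≡ true → lookup W′ u ≡ true) →
    ∀ e → bit (inside W e) ≤ bit (inside W′ e)
  inside-⊆ {W} {W′} W⊆W′ (u , v) with lookup W u in Wu | lookup W v in Wv
  ... | false | _     = z≤n
  ... | true  | false = z≤n
  ... | true  | true  rewrite W⊆W′ u Wu | W⊆W′ v Wv = ≤-refl

  inside-edge : ∀ {W : Subset n} u v → lookup W u ≡ true → lookup W v ≡ true → inside W (edge u v) ≡ true
  inside-edge u v Wu Wv with does (u Fin.<? v)
  ... | true  rewrite Wu | Wv = refl
  ... | false rewrite Wu | Wv = refl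

  inside-pairs : ∀ {W : Subset n} vs → (∀ v → v ∈ vs → lookup W v ≡ true) → All (λ e → inside W e ≡ true) (pairs vs)
  inside-pairs {W} []       vs⊆W = []
  inside-pairs {W} (v ∷ vs) vs⊆W = All.++⁺ (All.map⁺ (All.tabulate λ {u} u∈ → inside-edge {W = W} v u (vs⊆W v (here refl)) (vs⊆W u (there u∈))))
    (inside-pairs {W} vs λ u u∈ → vs⊆W u (there u∈))
    where import Data.List.Relation.Unary.All.Properties as All

  -- Search through all subsets, so that the event has an indicator with values in ℕ.
  excess? : ∀ X (G : Graph n) → Dec (Excess X G)
  excess? X G = anySubset? λ S → card S + X ≤? edgesIn S G

  excess-↭ : ∀ {X} {G G′ : Graph n} → G ↭ G′ → Excess X G → Excess X G′
  excess-↭ {X} G↭G′ (S , le) = S , ≤-trans le (≤-reflexive (total-↭ (bit ∘ inside S) G↭G′))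

  -- Every edge of `K₂` lies inside `W`, so each one in the tail of the string contributes; edges
  -- selected from `K₁` can only add.
  edgesIn-select : ∀ (W : Subset n) s K₁ K₂ → All (λ e → inside W e ≡ true) K₂ →
    length s ≡ length (K₁ ++ K₂) → ones (drop (length K₁) s) ≤ edgesIn W (select s (K₁ ++ K₂))
  edgesIn-select W []          []       K₂       all len = z≤n
  edgesIn-select W (true ∷ s)  []       (e ∷ K₂) (eq ∷ all) len rewrite eq =
    s≤s (edgesIn-select W s [] K₂ all (suc-injective len))
  edgesIn-select W (false ∷ s) []       (e ∷ K₂) (eq ∷ all) len = edgesIn-select W s [] K₂ all (suc-injective len)
  edgesIn-select W (true ∷ s)  (e ∷ K₁) K₂       all len =
    ≤-trans (edgesIn-select W s K₁ K₂ all (suc-injective len)) (m≤n+m _ (bit (inside W e)))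
  edgesIn-select W (false ∷ s) (e ∷ K₁) K₂       all len = edgesIn-select W s K₁ K₂ all (suc-injective len)

ones-++ : ∀ s t → ones (s ++ t) ≡ ones s + ones t
ones-++ = total-++ bit

ones-take : ∀ q s → ones (take q s) ≤ ones s
ones-take zero    s       = z≤n
ones-take (suc q) []      = z≤n
ones-take (suc q) (b ∷ s) = +-monoʳ-≤ (bit b) (ones-take q s)

take-++ : ∀ {a} {A : Set a} q (p s : List A) → q ≤ length p → take q (p ++ s) ≡ take q p
take-++ zero    p       s le       = refl
take-++ (suc q) (b ∷ p) s (s≤s le) = cong (b ∷_) (take-++ q p s le)

drop-++ : ∀ {a} {A : Set a} q (p s : List A) → drop (length p + q) (p ++ s) ≡ drop q s
drop-++ q []      s = refl
drop-++ q (b ∷ p) s = drop-++ q p s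

-- The exploration processes k vertices, querying each against all vertices not
-- yet reached.  A string of answers is good if it has at least x ones among the
-- first k ρ answers and at least h ones after the first r, and then y active
-- vertices of one component remain, between which no pair has been queried.
module Exploration {n k ρ x y r h X : ℕ}
  (k≤n : k ≤ n) (k+ρ+y≤n : k + ρ + y ≤ n) (k+y≤x : k + y ≤ x) (X<h : X < h) where

  Good : List Bool → Set
  Good s = x ≤ ones (take (k * ρ) s) × h ≤ ones (drop r s)

  good? : ∀ s → Dec (Good s)
  good? s = (x ≤? ones (take (k * ρ) s)) ×-dec (h ≤? ones (drop r s))

  -- The state after `s` processed vertices, with active vertices `U`, unreached vertices `T` and
  -- unqueried pairs `K`. `φ` and `ψ` are what remains of the two indicators once the edges `found`
  -- and the bits `answers` are fixed. `junk` holds pairs that the exploration will not query, and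
  -- `reached` is the vertex set of the current component only.
  record Stage (s : ℕ) (U T : List (Fin n)) (K : Graph n) (φ : Graph n → ℕ) (ψ : List Bool → ℕ) : Set where
    field
      answers     : List Bool
      found       : Graph n
      junk        : Graph n
      unprocessed : List (Fin n)
      reached     : Subset n
      K↭          : K ↭ junk ++ pairs unprocessed
      unprocessed↭ : unprocessed ↭ U ++ T
      size        : s + (length U + length T) ≡ n
      -- Every processed vertex has been queried against each vertex that is still unreached.
      queries     : s * length T ≤ length answers
      -- A positive answer activates a vertex, which is by now either processed or still active.
      -- Start vertices became active without an answer and only add slack.
      positives   : ones answers ≤ s + length U
      -- Answers and unqueried pairs together make up the whole string; this locates its last
      -- `tri y` bits after position `r`.
      remaining   : length answers + length K ≡ r + tri y
      active⊆     : ∀ u → u ∈ U → lookup reached u ≡ true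
      connected   : card reached ≤ suc (edgesIn reached found)
      φ-↭         : ∀ {G G′} → G ↭ G′ → φ G ≡ φ G′
      φ-excess    : ∀ G → Excess X (found ++ G) → 1 ≤ φ G
      ψ≤1         : ∀ s → ψ s ≤ 1
      ψ-good      : ∀ s → 1 ≤ ψ s → Good (answers ++ s)

  -- While u is processed: it is not adjacent to T₁ and has not been queried against T₂.
  record Loop (s : ℕ) (u : Fin n) (U T₁ T₂ : List (Fin n)) (K : Graph n) (φ : Graph n → ℕ) (ψ : List Bool → ℕ) : Set where
    field
      answers     : List Bool
      found       : Graph n
      junk        : Graph n
      unprocessed : List (Fin n)
      reached     : Subset n
      K↭          : K ↭ map (edge u) T₂ ++ junk ++ pairs unprocessed
      unprocessed↭ : unprocessed ↭ U ++ T₁ ++ T₂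
      size        : suc s + (length U + (length T₁ + length T₂)) ≡ n
      queries     : s * (length T₁ + length T₂) + length T₁ ≤ length answers
      positives   : ones answers ≤ suc s + length U
      remaining   : length answers + length K ≡ r + tri y
      u∈          : lookup reached u ≡ true
      active⊆     : ∀ v → v ∈ U → lookup reached v ≡ true
      connected   : card reached ≤ suc (edgesIn reached found)
      φ-↭         : ∀ {G G′} → G ↭ G′ → φ G ≡ φ G′
      φ-excess    : ∀ G → Excess X (found ++ G) → 1 ≤ φ G
      ψ≤1         : ∀ s → ψ s ≤ 1
      ψ-good      : ∀ s → 1 ≤ ψ s → Good (answers ++ s)

  -- A good string forces at least `y` active vertices, so `ψ` vanishes if there are fewer.
  -- Otherwise `tri y` pairs inside `U` are placed last, where the tail of the string answers them.
  finish : ∀ {U T K φ ψ} → Stage k U T K φ ψ → Dominates K φ ψ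
  finish {U} {T} {K} {φ} {ψ} st with y ≤? length U
  ... | no y≰U = dominates-select {K = K} λ s _ → few s (ψ s) refl
    where
    open Stage st
    -- If k ρ answers were given, at least k + y of them are positive, and at most k of the
    -- activated vertices have been processed. If fewer were given, then fewer than ρ vertices are
    -- unreached, and all vertices that are neither unreached nor processed are active.
    many : ∀ s → 1 ≤ ψ s → y ≤ length U
    many s ψs with k * ρ ≤? length answers
    ... | yes le = +-cancelˡ-≤ k _ _ (begin
      k + y                                    ≤⟨ k+y≤x ⟩
      x                                        ≤⟨ proj₁ (ψ-good s ψs) ⟩
      ones (take (k * ρ) (answers ++ s))       ≡⟨ cong ones (take-++ (k * ρ) answers s le) ⟩
      ones (take (k * ρ) answers)              ≤⟨ ones-take (k * ρ) answers ⟩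
      ones answers                             ≤⟨ positives ⟩
      k + length U                             ∎)
      where open ≤-Reasoning
    ... | no ≰ = +-cancelˡ-≤ (k + length T) _ _ (begin
      k + length T + y            ≤⟨ +-monoˡ-≤ y (+-monoʳ-≤ k (<⇒≤ T<ρ)) ⟩
      k + ρ + y                   ≤⟨ k+ρ+y≤n ⟩
      n                           ≡⟨ size ⟨
      k + (length U + length T)   ≡⟨ arith k (length U) (length T) ⟩
      k + length T + length U     ∎)
      where
      open ≤-Reasoning
      T<ρ : length T < ρ
      T<ρ = *-cancelˡ-< k _ _ (≤-<-trans queries (≰⇒> ≰))
      arith : ∀ k u t → k + (u + t) ≡ k + t + u
      arith = solve-∀
    few : ∀ s b → b ≡ ψ s → b ≤ φ (select s K)
    few s zero    _  = z≤n
    few s (suc b) eq = contradiction (many s (subst (1 ≤_) eq (s≤s z≤n))) y≰U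
  ... | yes y≤U with pairs-++ U T
  ... | J , UT↭ = dominates-↭ K↭K₁K₂ φ-↭ (dominates-select {K = K₁ ++ K₂} λ s len → enough s len (ψ s) refl)
    where
    open Stage st
    w = tri y
    -- Pairs inside `U` beyond the first `tri y` join the ignored part, so that the tail starts
    -- exactly at position `r`.
    K₁ = (junk ++ J) ++ drop w (pairs U)
    K₂ = take w (pairs U)
    K↭K₁K₂ : K ↭ K₁ ++ K₂
    K↭K₁K₂ = begin
      K                                                      ↭⟨ K↭ ⟩
      junk ++ pairs unprocessed                              ↭⟨ ++⁺ˡ junk (↭-trans (pairs-↭ unprocessed↭) UT↭) ⟩
      junk ++ J ++ pairs U                                   ≡⟨ cong (λ z → junk ++ J ++ z) (take++drop≡id w (pairs U)) ⟨
      junk ++ J ++ K₂ ++ drop w (pairs U)                    ↭⟨ ↭-assoc junk J _ ⟨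
      (junk ++ J) ++ K₂ ++ drop w (pairs U)                  ↭⟨ ++⁺ˡ (junk ++ J) (++-comm K₂ (drop w (pairs U))) ⟩
      (junk ++ J) ++ drop w (pairs U) ++ K₂                  ↭⟨ ↭-assoc (junk ++ J) (drop w (pairs U)) K₂ ⟨
      K₁ ++ K₂                                               ∎
      where open PermutationReasoning
    length-K₂ : length K₂ ≡ w
    length-K₂ = trans (length-take w (pairs U)) (m≤n⇒m⊓n≡m (≤-trans (tri-mono y≤U) (≤-reflexive (sym (length-pairs U)))))
    r≡ : r ≡ length answers + length K₁
    r≡ = +-cancelʳ-≡ (tri y) _ _ (begin
      r + tri y                                  ≡⟨ remaining ⟨
      length answers + length K                  ≡⟨ cong (length answers +_) (↭-length K↭K₁K₂) ⟩
      length answers + length (K₁ ++ K₂)         ≡⟨ cong (length answers +_) (length-++ K₁) ⟩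
      length answers + (length K₁ + length K₂)   ≡⟨ cong (λ z → length answers + (length K₁ + z)) length-K₂ ⟩
      length answers + (length K₁ + tri y)       ≡⟨ +-assoc (length answers) (length K₁) (tri y) ⟨
      length answers + length K₁ + tri y         ∎)
      where open ≡-Reasoning
    enough : ∀ s → length s ≡ length (K₁ ++ K₂) → ∀ b → b ≡ ψ s → b ≤ φ (select s (K₁ ++ K₂))
    enough s len zero    _  = z≤n
    enough s len (suc b) eq = ≤-trans (subst (_≤ 1) (sym eq) (ψ≤1 s)) (φ-excess _ (reached , (begin
      card reached + X
        ≤⟨ +-monoˡ-≤ X connected ⟩
      suc (edgesIn reached found) + X
        ≡⟨ +-suc (edgesIn reached found) X ⟨
      edgesIn reached found + suc X
        ≤⟨ +-monoʳ-≤ (edgesIn reached found) (begin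
             -- The strict inequality pays for the one vertex that a tree has in excess of its
             -- edges.
             suc X                                                       ≤⟨ X<h ⟩
             h                                                           ≤⟨ proj₂ (ψ-good s (subst (1 ≤_) eq (s≤s z≤n))) ⟩
             ones (drop r (answers ++ s))                                ≡⟨ cong (λ z → ones (drop z (answers ++ s))) r≡ ⟩
             ones (drop (length answers + length K₁) (answers ++ s))     ≡⟨ cong ones (drop-++ (length K₁) answers s) ⟩
             ones (drop (length K₁) s)                                   ≤⟨ edgesIn-select reached s K₁ K₂ (All.take⁺ w (inside-pairs {W = reached} U active⊆)) len ⟩
             edgesIn reached (select s (K₁ ++ K₂))                       ∎) ⟩
      edgesIn reached found + edgesIn reached (select s (K₁ ++ K₂))
        ≡⟨ total-++ (bit ∘ inside reached) found _ ⟨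
      edgesIn reached (found ++ select s (K₁ ++ K₂)) ∎)))
      where open ≤-Reasoning

  -- The pairs between `u` and the other active vertices go to `junk`: querying them could not reach
  -- a new vertex.
  start : ∀ {s u U T K φ ψ} → Stage s (u ∷ U) T K φ ψ → Loop s u U [] T K φ ψ
  start {s} {u} {U} {T} {K} st = record
    { answers = answers ; found = found ; junk = junk ++ map (edge u) U ; unprocessed = U ++ T ; reached = reached
    ; K↭ = K↭′
    ; unprocessed↭ = ↭-refl
    ; size = trans (sym (+-suc s _)) size
    ; queries = ≤-trans (≤-reflexive (+-identityʳ (s * length T))) queries
    ; positives = ≤-trans positives (≤-reflexive (+-suc s (length U)))
    ; remaining = remaining
    ; u∈ = active⊆ u (here refl)
    ; active⊆ = λ v v∈ → active⊆ v (there v∈)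
    ; connected = connected ; φ-↭ = φ-↭ ; φ-excess = φ-excess ; ψ≤1 = ψ≤1 ; ψ-good = ψ-good
    }
    where
    open Stage st
    K↭′ : K ↭ map (edge u) T ++ (junk ++ map (edge u) U) ++ pairs (U ++ T)
    K↭′ = begin
      K                                                                 ↭⟨ K↭ ⟩
      junk ++ pairs unprocessed                                         ↭⟨ ++⁺ˡ junk (pairs-↭ unprocessed↭) ⟩
      junk ++ map (edge u) (U ++ T) ++ pairs (U ++ T)                   ≡⟨ cong (λ z → junk ++ z ++ pairs (U ++ T)) (map-++ (edge u) U T) ⟩
      junk ++ (map (edge u) U ++ map (edge u) T) ++ pairs (U ++ T)      ↭⟨ ++⁺ˡ junk (↭-assoc (map (edge u) U) (map (edge u) T) _) ⟩
      junk ++ map (edge u) U ++ map (edge u) T ++ pairs (U ++ T)        ↭⟨ ↭-assoc junk (map (edge u) U) _ ⟨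
      (junk ++ map (edge u) U) ++ map (edge u) T ++ pairs (U ++ T)      ↭⟨ shifts (junk ++ map (edge u) U) (map (edge u) T) ⟩
      map (edge u) T ++ (junk ++ map (edge u) U) ++ pairs (U ++ T)      ∎
      where open PermutationReasoning

  card-⊥ : card (⊥ {n}) ≤ 0
  card-⊥ = ≤-trans (∑-mono-≤ {n} λ v → ≤-reflexive (cong bit (lookup-replicate v false))) (≤-reflexive (sum-replicate-zero n))

  -- No query is made. `reached` shrinks to the new start vertex, for which the tree inequality is
  -- trivial; edges found in earlier components may stay in `found`, where they do no harm to a
  -- lower bound on `edgesIn`.
  restart : ∀ {s u T K φ ψ} → Stage s [] (u ∷ T) K φ ψ → Stage s (u ∷ []) T K φ ψ
  restart {s} {u} {T} st = record
    { answers = answers ; found = found ; junk = junk ; unprocessed = unprocessed ; reached = ⊥ [ u ]≔ true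
    ; K↭ = K↭
    ; unprocessed↭ = unprocessed↭
    ; size = size
    ; queries = ≤-trans (*-monoʳ-≤ s (n≤1+n (length T))) queries
    ; positives = ≤-trans positives (+-monoʳ-≤ s (z≤n {1}))
    ; remaining = remaining
    ; active⊆ = λ { v (here refl) → lookup∘update v ⊥ true }
    ; connected = ≤-trans (card-insert ⊥ u) (s≤s (≤-trans card-⊥ z≤n))
    ; φ-↭ = φ-↭ ; φ-excess = φ-excess ; ψ≤1 = ψ≤1 ; ψ-good = ψ-good
    }
    where open Stage st

  end : ∀ {s u U T₁ K φ ψ} → Loop s u U T₁ [] K φ ψ → Stage (suc s) U T₁ K φ ψ
  end {s} {u} {U} {T₁} lp = record
    { answers = answers ; found = found ; junk = junk ; unprocessed = unprocessed ; reached = reached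
    ; K↭ = K↭
    ; unprocessed↭ = ↭-trans unprocessed↭ (↭-reflexive (cong (U ++_) (Data.List.Properties.++-identityʳ T₁)))
    ; size = subst (λ z → suc s + (length U + z) ≡ n) (+-identityʳ (length T₁)) size
    -- `u` itself has been queried against all of `T₁`, which turns s |T₁| + |T₁| into (s + 1) |T₁|.
    ; queries = ≤-trans (≤-reflexive (+-comm (length T₁) (s * length T₁)))
        (subst (λ z → s * z + length T₁ ≤ length answers) (+-identityʳ (length T₁)) queries)
    ; positives = positives ; remaining = remaining ; active⊆ = active⊆
    ; connected = connected ; φ-↭ = φ-↭ ; φ-excess = φ-excess ; ψ≤1 = ψ≤1 ; ψ-good = ψ-good
    }
    where
    open Loop lp
    import Data.List.Properties

  module _ {s u U T₁ v T₂ K φ ψ} (lp : Loop s u U T₁ (v ∷ T₂) K φ ψ) where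
    open Loop lp

    rest : Graph n
    rest = map (edge u) T₂ ++ junk ++ pairs unprocessed

    private
      remaining′ : ∀ b → length (answers ∷ʳ b) + length rest ≡ r + tri y
      remaining′ b = begin
        length (answers ∷ʳ b) + length rest        ≡⟨ cong (_+ length rest) (length-++ answers) ⟩
        length answers + 1 + length rest           ≡⟨ +-assoc (length answers) 1 _ ⟩
        length answers + length (edge u v ∷ rest)  ≡⟨ cong (length answers +_) (↭-length K↭) ⟨
        length answers + length K                  ≡⟨ remaining ⟩
        r + tri y                                  ∎
        where open ≡-Reasoning

      length-∷ʳ : ∀ b → length (answers ∷ʳ b) ≡ suc (length answers)
      length-∷ʳ b = trans (length-++ answers) (+-comm (length answers) 1)

      ones-∷ʳ : ∀ b → ones (answers ∷ʳ b) ≡ bit b + ones answers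
      ones-∷ʳ b = trans (ones-++ answers [ b ]) (trans (+-comm (ones answers) _) (cong (_+ ones answers) (+-identityʳ (bit b))))

      ψ-good′ : ∀ b s → 1 ≤ ψ (b ∷ s) → Good ((answers ∷ʳ b) ++ s)
      ψ-good′ b s ψs = subst Good (sym (++-assoc answers [ b ] s)) (ψ-good (b ∷ s) ψs)

    negative : Loop s u U (v ∷ T₁) T₂ rest φ (ψ ∘ (false ∷_))
    negative = record
      { answers = answers ∷ʳ false ; found = found ; junk = junk ; unprocessed = unprocessed ; reached = reached
      ; K↭ = ↭-refl
      ; unprocessed↭ = ↭-trans unprocessed↭ (++⁺ˡ U (shift v T₁ T₂))
      ; size = subst (λ z → suc s + (length U + z) ≡ n) (+-suc (length T₁) (length T₂)) size
      ; queries = begin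
          s * suc (length T₁ + length T₂) + suc (length T₁)       ≡⟨ +-suc (s * suc (length T₁ + length T₂)) (length T₁) ⟩
          suc (s * suc (length T₁ + length T₂) + length T₁)       ≡⟨ cong (λ z → suc (s * z + length T₁)) (+-suc (length T₁) (length T₂)) ⟨
          suc (s * (length T₁ + suc (length T₂)) + length T₁)     ≤⟨ s≤s queries ⟩
          suc (length answers)                                    ≡⟨ length-∷ʳ false ⟨
          length (answers ∷ʳ false)                               ∎
      ; positives = ≤-trans (≤-reflexive (ones-∷ʳ false)) positives
      ; remaining = remaining′ false
      ; u∈ = u∈
      ; active⊆ = active⊆
      ; connected = connected ; φ-↭ = φ-↭ ; φ-excess = φ-excess
      ; ψ≤1 = λ s → ψ≤1 (false ∷ s)
      ; ψ-good = ψ-good′ false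
      }
      where open ≤-Reasoning

    positive : Loop s u (v ∷ U) T₁ T₂ rest (φ ∘ (edge u v ∷_)) (ψ ∘ (true ∷_))
    positive = record
      { answers = answers ∷ʳ true ; found = edge u v ∷ found ; junk = junk ; unprocessed = unprocessed
      ; reached = reached′
      ; K↭ = ↭-refl
      ; unprocessed↭ = ↭-trans unprocessed↭ move
      ; size = trans (arith s (length U) (length T₁) (length T₂)) size
      ; queries = begin
          s * (length T₁ + length T₂) + length T₁            ≤⟨ +-monoˡ-≤ (length T₁) (*-monoʳ-≤ s (+-monoʳ-≤ (length T₁) (n≤1+n (length T₂)))) ⟩
          s * (length T₁ + suc (length T₂)) + length T₁      ≤⟨ queries ⟩
          length answers                                     ≤⟨ n≤1+n (length answers) ⟩
          suc (length answers)                               ≡⟨ length-∷ʳ true ⟨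
          length (answers ∷ʳ true)                           ∎
      ; positives = begin
          ones (answers ∷ʳ true)       ≡⟨ ones-∷ʳ true ⟩
          suc (ones answers)           ≤⟨ s≤s positives ⟩
          suc (suc s + length U)       ≡⟨ +-suc (suc s) (length U) ⟨
          suc s + suc (length U)       ∎
      ; remaining = remaining′ true
      ; u∈ = insert-⊇ reached v u u∈
      ; active⊆ = λ { w (here refl) → lookup∘update v reached true ; w (there w∈) → insert-⊇ reached v w (active⊆ w w∈) }
      -- The new vertex brings along the edge to `u`, and both ends lie in the enlarged set, so the
      -- tree inequality persists.
      ; connected = begin
          card reached′                                                              ≤⟨ card-insert reached v ⟩
          suc (card reached)                                                         ≤⟨ s≤s connected ⟩
          suc (suc (edgesIn reached found))                                          ≤⟨ s≤s (s≤s (total-mono {f = bit ∘ inside reached} {bit ∘ inside reached′} found λ e _ → inside-⊆ {W = reached} {reached′} (insert-⊇ reached v) e)) ⟩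
          suc (bit true + edgesIn reached′ found)                                    ≡⟨ cong (λ b → suc (bit b + edgesIn reached′ found)) (inside-edge {W = reached′} u v (insert-⊇ reached v u u∈) (lookup∘update v reached true)) ⟨
          suc (bit (inside reached′ (edge u v)) + edgesIn reached′ found)            ∎
      ; φ-↭ = λ p → φ-↭ (prep (edge u v) p)
      ; φ-excess = λ G ex → φ-excess (edge u v ∷ G) (excess-↭ (↭-sym (shift (edge u v) found G)) ex)
      ; ψ≤1 = λ s → ψ≤1 (true ∷ s)
      ; ψ-good = ψ-good′ true
      }
      where
      open ≤-Reasoning
      reached′ = reached [ v ]≔ true
      arith : ∀ s a b c → suc s + (suc a + (b + c)) ≡ suc s + (a + (b + suc c))
      arith = solve-∀
      move : U ++ T₁ ++ v ∷ T₂ ↭ v ∷ U ++ T₁ ++ T₂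
      move = ↭-trans (++⁺ˡ U (shift v T₁ T₂)) (shift v U (T₁ ++ T₂))

  mutual
    -- `j` counts the vertices still to be processed and decreases from one vertex to the next,
    -- while `T₂` shrinks within `process`. Running out of vertices would mean s = n, contrary to s
    -- < k ≤ n.
    explore : ∀ j {s U T K φ ψ} → s + j ≡ k → Stage s U T K φ ψ → Dominates K φ ψ
    explore zero {s} eq st with refl ← trans (sym (+-identityʳ s)) eq = finish st
    explore (suc j) {U = u ∷ U} eq st = process j eq (start st)
    explore (suc j) {U = []} {T = u ∷ T} eq st = process j eq (start (restart st))
    explore (suc j) {s} {U = []} {T = []} eq st = contradiction (begin
      suc n                 ≡⟨ cong suc (Stage.size st) ⟨
      suc (s + 0)           ≤⟨ s≤s (+-monoʳ-≤ s z≤n) ⟩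
      suc (s + j)           ≡⟨ +-suc s j ⟨
      s + suc j             ≡⟨ eq ⟩
      k                     ≤⟨ k≤n ⟩
      n                     ∎) 1+n≰n
      where open ≤-Reasoning

    process : ∀ j {s u U T₁ T₂ K φ ψ} → s + suc j ≡ k → Loop s u U T₁ T₂ K φ ψ → Dominates K φ ψ
    process j {s} {T₂ = []}     eq lp = explore j (trans (sym (+-suc s j)) eq) (end lp)
    process j {T₂ = v ∷ T₂} {K = K} eq lp = dominates-↭ {K = K} K↭ φ-↭
      (dominates-query {K = rest lp} (process j eq (positive lp)) (process j eq (negative lp)))
      where open Loop lp

  explored : r + tri y ≡ tri n →
    Dominates (completeGraph n) (λ G → bit (does (excess? X G))) (λ s → bit (does (good? s)))
  explored L≡ = explore k {U = []} {T = allFin n} refl (record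
    { answers = [] ; found = [] ; junk = [] ; unprocessed = allFin n ; reached = ⊥
    ; K↭ = completeGraph-↭
    ; unprocessed↭ = ↭-refl
    ; size = length-tabulate {n = n} (λ i → i)
    ; queries = z≤n
    ; positives = z≤n
    ; remaining = trans (length-completeGraph {n}) (sym L≡)
    ; active⊆ = λ _ ()
    ; connected = ≤-trans card-⊥ z≤n
    ; φ-↭ = λ {G} {G′} p → cong bit (does-⇔ (mk⇔ (excess-↭ p) (excess-↭ (↭-sym p))) (excess? X G) (excess? X G′))
    ; φ-excess = λ G ex → ≤-reflexive (sym (cong bit (dec-true (excess? X G) ex)))
    ; ψ≤1 = λ s → bit≤1 (does (good? s))
    ; ψ-good = λ s → good s (good? s)
    })
    where
    good : ∀ s (d : Dec (Good s)) → 1 ≤ bit (does d) → Good s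
    good s (yes g) _ = g

-- Choice of the parameters

-- With q = 1 + p the hypotheses say that λ ≥ ½ + 1/(2q) up to rounding, that
-- λ ≤ B, and that n lies between 32 q² t and 64 q² t.
module Parameters (p B u n m c : ℕ) (c≡ : c ≡ 1024 * (suc p * suc p))
  (1≤u : 1 ≤ u) (lower : 32 * (suc p * suc p) * (c * u) ≤ n) (upper : n ≤ 64 * (suc p * suc p) * (c * u))
  (dense : suc (suc p) * n ≤ 2 * suc p * suc m) (m≤Bn : m ≤ B * n) (2B<n : 2 * B < n) where

  -- Before rounding, 2 m / n ≥ 1 + 1/q, and ρ / n ≥ 1 - 1/(4q) because 32 q² t ≤ n. So the first k
  -- ρ answers contain on average at least k + 2t ones; `x` asks for k + t, and the remainder covers
  -- rounding and the deviation. `h` is at most half the mean number of edges among the `tri t`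
  -- pairs at the end.
  q t k x ρ h L : ℕ
  q = suc p
  t = c * u
  k = 4 * (q * t)
  x = k + t
  ρ = n ∸ 8 * (q * t)
  h = 2 * u
  L = tri n

  open ≤-Reasoning

  1≤q² : 1 ≤ q * q
  1≤q² = s≤s z≤n

  16≤c : 16 ≤ c
  16≤c = subst (16 ≤_) (sym c≡) (≤-trans (m≤m+n 16 1008) (*-monoʳ-≤ 1024 1≤q²))

  16u≤t : 16 * u ≤ t
  16u≤t = *-monoˡ-≤ u 16≤c

  16≤t : 16 ≤ t
  16≤t = ≤-trans (*-monoʳ-≤ 16 1≤u) 16u≤t

  8qt≤n : 8 * (q * t) ≤ n
  8qt≤n = begin
    8 * (q * t)                   ≤⟨ *-mono-≤ (m≤m+n 8 24) (*-monoˡ-≤ t (m≤n*m q q)) ⟩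
    32 * (q * q * t)              ≡⟨ *-assoc 32 (q * q) t ⟨
    32 * (q * q) * t              ≤⟨ lower ⟩
    n                             ∎

  8qt+ρ : 8 * (q * t) + ρ ≡ n
  8qt+ρ = m+[n∸m]≡n 8qt≤n

  t≤qt : t ≤ q * t
  t≤qt = m≤n*m t q

  k≤n : k ≤ n
  k≤n = ≤-trans (*-monoˡ-≤ (q * t) (m≤m+n 4 4)) 8qt≤n

  t≤n : t ≤ n
  t≤n = ≤-trans t≤qt (≤-trans (m≤n*m (q * t) 8) 8qt≤n)

  k+ρ+t≤n : k + ρ + t ≤ n
  k+ρ+t≤n = begin
    k + ρ + t                     ≤⟨ +-monoʳ-≤ (k + ρ) (≤-trans t≤qt (m≤n*m (q * t) 4)) ⟩
    k + ρ + k                     ≡⟨ arith (q * t) ρ ⟩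
    8 * (q * t) + ρ               ≡⟨ 8qt+ρ ⟩
    n                             ∎
    where
    arith : ∀ a ρ → 4 * a + ρ + 4 * a ≡ 8 * a + ρ
    arith = solve-∀

  u<h : u < h
  u<h = begin
    1 + u       ≤⟨ +-monoˡ-≤ u 1≤u ⟩
    u + u       ≡⟨ cong (u +_) (+-identityʳ u) ⟨
    2 * u       ∎

  16≤n : 16 ≤ n
  16≤n = ≤-trans 16≤t t≤n

  instance
    n≢0 : NonZero n
    n≢0 = >-nonZero (≤-trans (s≤s z≤n) 16≤n)
    t≢0 : NonZero t
    t≢0 = >-nonZero (≤-trans (s≤s z≤n) 16≤t)

  2L≤n² : 2 * L ≤ n * n
  2L≤n² = ≤-trans (m≤m+n (2 * L) n) (≤-reflexive (2tri n))

  kρ≤L : k * ρ ≤ L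
  kρ≤L = *-cancelˡ-≤ 2 (+-cancelʳ-≤ n _ _ (begin
    2 * (k * ρ) + n               ≤⟨ +-mono-≤ (≤-trans (*-monoʳ-≤ 2 (*-monoʳ-≤ k ρ≤n)) (≤-reflexive (arith (q * t) n))) (≤-trans n≤ (≤-reflexive (arith′ (q * t) n))) ⟩
    8 * (q * t) * n + 16 * (q * t) * n  ≡⟨ arith″ (q * t) n ⟩
    24 * (q * t) * n              ≤⟨ *-monoˡ-≤ n 24qt≤n ⟩
    n * n                         ≡⟨ 2tri n ⟨
    2 * L + n                     ∎))
    where
    ρ≤n : ρ ≤ n
    ρ≤n = m∸n≤m n (8 * (q * t))
    n≤ : n ≤ n * (16 * (q * t))
    n≤ = m≤m*n n (16 * (q * t)) {{m*n≢0 16 (q * t) {{_}} {{m*n≢0 q t}}}}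
    24qt≤n : 24 * (q * t) ≤ n
    24qt≤n = begin
      24 * (q * t)                  ≤⟨ *-mono-≤ (m≤m+n 24 8) (*-monoˡ-≤ t (m≤n*m q q)) ⟩
      32 * (q * q * t)              ≡⟨ *-assoc 32 (q * q) t ⟨
      32 * (q * q) * t              ≤⟨ lower ⟩
      n                             ∎
    arith : ∀ a n → 2 * (4 * a * n) ≡ 8 * a * n
    arith = solve-∀
    arith′ : ∀ a n → n * (16 * a) ≡ 16 * a * n
    arith′ = solve-∀
    arith″ : ∀ a n → 8 * a * n + 16 * a * n ≡ 24 * a * n
    arith″ = solve-∀

  16q²≤n : 16 * (q * q) ≤ n
  16q²≤n = begin
    16 * (q * q)          ≤⟨ *-monoˡ-≤ (q * q) (m≤m+n 16 16) ⟩
    32 * (q * q)          ≤⟨ m≤m*n (32 * (q * q)) t ⟩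
    32 * (q * q) * t      ≤⟨ lower ⟩
    n                     ∎

  n≤2m : n ≤ 2 * m
  n≤2m = *-cancelˡ-≤ q (+-cancelʳ-≤ n _ _ (begin
    q * n + n             ≡⟨ +-comm (q * n) n ⟩
    suc q * n             ≤⟨ dense ⟩
    2 * q * suc m         ≡⟨ arith q m ⟩
    q * (2 * m) + 2 * q   ≤⟨ +-monoʳ-≤ (q * (2 * m)) (≤-trans (*-mono-≤ (m≤m+n 2 14) (m≤n*m q q)) 16q²≤n) ⟩
    q * (2 * m) + n       ∎))
    where
    arith : ∀ q m → 2 * q * suc m ≡ q * (2 * m) + 2 * q
    arith = solve-∀

  2≤m : 2 ≤ m
  2≤m = *-cancelˡ-≤ 2 (≤-trans (m≤m+n 4 12) (≤-trans 16≤n n≤2m))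

  m≤L : m ≤ L
  m≤L = *-cancelˡ-≤ 2 (+-cancelʳ-≤ n _ _ (begin
    2 * m + n             ≤⟨ +-monoˡ-≤ n (*-monoʳ-≤ 2 m≤Bn) ⟩
    2 * (B * n) + n       ≡⟨ arith B n ⟩
    suc (2 * B) * n       ≤⟨ *-monoˡ-≤ n 2B<n ⟩
    n * n                 ≡⟨ 2tri n ⟨
    2 * L + n             ∎))
    where
    arith : ∀ B n → 2 * (B * n) + n ≡ suc (2 * B) * n
    arith = solve-∀

  -- (4q − 1) n ≤ 4 q ρ
  ρ-lower : (4 * p + 3) * n ≤ 4 * q * ρ
  ρ-lower = +-cancelʳ-≤ n _ _ (begin
    (4 * p + 3) * n + n               ≡⟨ arith p n ⟩
    4 * q * n                         ≡⟨ cong (4 * q *_) 8qt+ρ ⟨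
    4 * q * (8 * (q * t) + ρ)         ≡⟨ arith′ q t ρ ⟩
    4 * q * ρ + 32 * (q * q) * t      ≤⟨ +-monoʳ-≤ (4 * q * ρ) lower ⟩
    4 * q * ρ + n                     ∎)
    where
    arith : ∀ p n → (4 * p + 3) * n + n ≡ 4 * suc p * n
    arith = solve-∀
    arith′ : ∀ q t ρ → 4 * q * (8 * (q * t) + ρ) ≡ 4 * q * ρ + 32 * (q * q) * t
    arith′ = solve-∀

  -- (8q² + 8q − 1) n ≤ 16 q² m
  m-lower : (8 * (p * p) + 24 * p + 15) * n ≤ 16 * (q * q) * m
  m-lower = +-cancelʳ-≤ n _ _ (begin
    (8 * (p * p) + 24 * p + 15) * n + n  ≡⟨ arith p n ⟩
    8 * q * (suc q * n)                  ≤⟨ *-monoʳ-≤ (8 * q) dense ⟩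
    8 * q * (2 * q * suc m)              ≡⟨ arith′ q m ⟩
    16 * (q * q) * m + 16 * (q * q)      ≤⟨ +-monoʳ-≤ (16 * (q * q) * m) 16q²≤n ⟩
    16 * (q * q) * m + n                 ∎)
    where
    arith : ∀ p n → (8 * (p * p) + 24 * p + 15) * n + n ≡ 8 * suc p * (suc (suc p) * n)
    arith = solve-∀
    arith′ : ∀ q m → 8 * q * (2 * q * suc m) ≡ 16 * (q * q) * m + 16 * (q * q)
    arith′ = solve-∀

  -- With 2 L ≤ n² this says that the mean number of ones among the first k ρ answers is at least k
  -- + 3t/2, which is t/2 above `x`. It is the product of the two preceding bounds, with a
  -- polynomial in `p` to spare.
  mean₁ : (8 * q + 3) * (n * n) ≤ 16 * (q * (ρ * m))
  mean₁ = *-cancelˡ-≤ (4 * (q * q)) (begin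
    4 * (q * q) * ((8 * q + 3) * (n * n))
      ≤⟨ m≤m+n _ ((12 * (p * p) + 12 * p + 1) * (n * n)) ⟩
    4 * (q * q) * ((8 * q + 3) * (n * n)) + (12 * (p * p) + 12 * p + 1) * (n * n)
      ≡⟨ arith p n ⟩
    (4 * p + 3) * n * ((8 * (p * p) + 24 * p + 15) * n)
      ≤⟨ *-mono-≤ ρ-lower m-lower ⟩
    4 * q * ρ * (16 * (q * q) * m)
      ≡⟨ arith′ q ρ m ⟩
    4 * (q * q) * (16 * (q * (ρ * m))) ∎)
    where
    arith : ∀ p n → 4 * (suc p * suc p) * ((8 * suc p + 3) * (n * n)) + (12 * (p * p) + 12 * p + 1) * (n * n)
      ≡ (4 * p + 3) * n * ((8 * (p * p) + 24 * p + 15) * n)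
    arith = solve-∀
    arith′ : ∀ q ρ m → 4 * q * ρ * (16 * (q * q) * m) ≡ 4 * (q * q) * (16 * (q * (ρ * m)))
    arith′ = solve-∀

  gap₁ : 4 * (L * x) + t * (n * n) ≤ 4 * (m * (k * ρ))
  gap₁ = begin
    4 * (L * x) + t * (n * n)                      ≡⟨ arith₁ L x (t * (n * n)) ⟩
    2 * L * (2 * x) + t * (n * n)                  ≤⟨ +-monoˡ-≤ (t * (n * n)) (*-monoˡ-≤ (2 * x) 2L≤n²) ⟩
    n * n * (2 * x) + t * (n * n)                  ≡⟨ arith₂ n q t ⟩
    t * ((8 * q + 3) * (n * n))                    ≤⟨ *-monoʳ-≤ t mean₁ ⟩
    t * (16 * (q * (ρ * m)))                       ≡⟨ arith₃ t q ρ m ⟩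
    4 * (m * (k * ρ))                              ∎
    where
    arith₁ : ∀ L x r → 4 * (L * x) + r ≡ 2 * L * (2 * x) + r
    arith₁ = solve-∀
    arith₂ : ∀ n q t → n * n * (2 * (4 * (q * t) + t)) + t * (n * n) ≡ t * ((8 * q + 3) * (n * n))
    arith₂ = solve-∀
    arith₃ : ∀ t q ρ m → t * (16 * (q * (ρ * m))) ≡ 4 * (m * (4 * (q * t) * ρ))
    arith₃ = solve-∀

  D₁ : ℕ
  D₁ = m * (k * ρ) ∸ L * x

  D₁+Lx : D₁ + L * x ≤ m * (k * ρ)
  D₁+Lx = ≤-reflexive (m∸n+n≡m {m * (k * ρ)} {L * x} (*-cancelˡ-≤ 4 (m+n≤o⇒m≤o (4 * (L * x)) gap₁)))

  tn²≤4D₁ : t * (n * n) ≤ 4 * D₁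
  tn²≤4D₁ = begin
    t * (n * n)                               ≤⟨ m+n≤o⇒m≤o∸n (t * (n * n)) (≤-trans (≤-reflexive (+-comm (t * (n * n)) (4 * (L * x)))) gap₁) ⟩
    4 * (m * (k * ρ)) ∸ 4 * (L * x)           ≡⟨ *-distribˡ-∸ 4 (m * (k * ρ)) (L * x) ⟨
    4 * D₁                                    ∎

  -- The deviation `D₁` is at least t n² / 4, whereas the variance term L m k ρ is of order t n⁴;
  -- the proportion of bad strings is therefore of order 1/t.
  few₁ : ∀ Bad N → D₁ * D₁ * Bad ≤ L * (m * (k * ρ)) * N → t * Bad ≤ 32 * (q * B) * N
  few₁ Bad N le = *-cancelˡ-≤ (t * (n * n) * (n * n)) {{m*n≢0 (t * (n * n)) (n * n) {{m*n≢0 t (n * n) {{t≢0}} {{m*n≢0 n n}}}} {{m*n≢0 n n}}}} (begin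
    t * (n * n) * (n * n) * (t * Bad)             ≡⟨ arith₁ t (n * n) Bad ⟩
    t * (n * n) * (t * (n * n)) * Bad             ≤⟨ *-monoˡ-≤ Bad (*-mono-≤ tn²≤4D₁ tn²≤4D₁) ⟩
    4 * D₁ * (4 * D₁) * Bad                       ≡⟨ arith₂ D₁ Bad ⟩
    16 * (D₁ * D₁ * Bad)                          ≤⟨ *-monoʳ-≤ 16 le ⟩
    16 * (L * (m * (k * ρ)) * N)                  ≡⟨ arith₃ L (m * (k * ρ)) N ⟩
    8 * (2 * L * (m * (k * ρ)) * N)               ≤⟨ *-monoʳ-≤ 8 (*-monoˡ-≤ N (*-mono-≤ 2L≤n² (*-mono-≤ m≤Bn (*-monoʳ-≤ k (m∸n≤m n (8 * (q * t))))))) ⟩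
    8 * (n * n * (B * n * (k * n)) * N)           ≡⟨ arith₄ n B q t N ⟩
    t * (n * n) * (n * n) * (32 * (q * B) * N)    ∎)
    where
    arith₁ : ∀ t s b → t * s * s * (t * b) ≡ t * s * (t * s) * b
    arith₁ = solve-∀
    arith₂ : ∀ D b → 4 * D * (4 * D) * b ≡ 16 * (D * D * b)
    arith₂ = solve-∀
    arith₃ : ∀ L r N → 16 * (L * r * N) ≡ 8 * (2 * L * r * N)
    arith₃ = solve-∀
    arith₄ : ∀ n B q t N → 8 * (n * n * (B * n * (4 * (q * t) * n)) * N) ≡ t * (n * n) * (n * n) * (32 * (q * B) * N)
    arith₄ = solve-∀

  w : ℕ
  w = tri t

  t²n≤8mw : t * t * n ≤ 8 * (m * w)
  t²n≤8mw = begin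
    t * t * n           ≤⟨ *-mono-≤ t²≤4w n≤2m ⟩
    4 * w * (2 * m)     ≡⟨ arith w m ⟩
    8 * (m * w)         ∎
    where
    arith : ∀ w m → 4 * w * (2 * m) ≡ 8 * (m * w)
    arith = solve-∀
    arith₁ : ∀ w t → 4 * w + 2 * t ≡ 2 * (2 * w + t)
    arith₁ = solve-∀
    arith₂ : ∀ s → s + s ≡ 2 * s
    arith₂ = solve-∀
    t²≤4w : t * t ≤ 4 * w
    t²≤4w = +-cancelʳ-≤ (2 * t) _ _ (begin
      t * t + 2 * t       ≤⟨ +-monoʳ-≤ (t * t) (*-monoˡ-≤ t (≤-trans (m≤m+n 2 14) 16≤t)) ⟩
      t * t + t * t       ≡⟨ arith₂ (t * t) ⟩
      2 * (t * t)         ≡⟨ cong (2 *_) (2tri t) ⟨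
      2 * (2 * w + t)     ≡⟨ arith₁ w t ⟨
      4 * w + 2 * t       ∎)

  -- The mean m w / L is at least t² / (4n) ≥ t / (256 q²), by w ≥ t² / 4, 2m ≥ n and `upper`. The
  -- factor 1024 in `c` makes this 4u, twice `h`.
  gap₂ : 2 * (L * h) ≤ m * w
  gap₂ = *-cancelˡ-≤ 8 (begin
    8 * (2 * (L * h))                    ≡⟨ arith₁ L u ⟩
    2 * L * (16 * u)                     ≤⟨ *-monoˡ-≤ (16 * u) 2L≤n² ⟩
    n * n * (16 * u)                     ≡⟨ *-assoc n n (16 * u) ⟩
    n * (n * (16 * u))                   ≤⟨ *-monoʳ-≤ n (*-monoˡ-≤ (16 * u) upper) ⟩
    n * (64 * (q * q) * t * (16 * u))    ≡⟨ arith₂ n (q * q) t u ⟩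
    t * (1024 * (q * q) * u) * n         ≡⟨ cong (λ z → t * (z * u) * n) c≡ ⟨
    t * t * n                            ≤⟨ t²n≤8mw ⟩
    8 * (m * w)                          ∎)
    where
    arith₁ : ∀ L u → 8 * (2 * (L * (2 * u))) ≡ 2 * L * (16 * u)
    arith₁ = solve-∀
    arith₂ : ∀ n s t u → n * (64 * s * t * (16 * u)) ≡ t * (1024 * s * u) * n
    arith₂ = solve-∀

  D₂ : ℕ
  D₂ = m * w ∸ L * h

  D₂+Lh : D₂ + L * h ≤ m * w
  D₂+Lh = ≤-reflexive (m∸n+n≡m (≤-trans (m≤m+n (L * h) _) gap₂))

  mw≤2D₂ : m * w ≤ 2 * D₂
  mw≤2D₂ = begin
    m * w                              ≡⟨ m+n∸n≡m (m * w) (m * w) ⟨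
    m * w + m * w ∸ m * w              ≤⟨ ∸-monoʳ-≤ (m * w + m * w) gap₂ ⟩
    m * w + m * w ∸ 2 * (L * h)        ≡⟨ cong (λ z → m * w + z ∸ 2 * (L * h)) (+-identityʳ (m * w)) ⟨
    2 * (m * w) ∸ 2 * (L * h)          ≡⟨ *-distribˡ-∸ 2 (m * w) (L * h) ⟨
    2 * D₂                             ∎

  -- The deviation is at least half the mean, so the bad proportion is at most 4 L / (m w), four
  -- times the reciprocal of the mean, hence at most c / t = 1/u.
  few₂ : ∀ Bad N → D₂ * D₂ * Bad ≤ L * (m * w) * N → t * Bad ≤ c * N
  few₂ Bad N le = *-cancelˡ-≤ (t * n) {{m*n≢0 t n}} (begin
    t * n * (t * Bad)                  ≡⟨ arith₁ t n Bad ⟩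
    t * t * n * Bad                    ≤⟨ *-monoˡ-≤ Bad t²n≤8mw ⟩
    8 * (m * w) * Bad                  ≡⟨ *-assoc 8 (m * w) Bad ⟩
    8 * (m * w * Bad)                  ≤⟨ *-monoʳ-≤ 8 reduced ⟩
    8 * (4 * L * N)                    ≡⟨ arith₂ L N ⟩
    16 * (2 * L * N)                   ≤⟨ *-monoʳ-≤ 16 (*-monoˡ-≤ N 2L≤n²) ⟩
    16 * (n * n * N)                   ≤⟨ *-monoʳ-≤ 16 (*-monoˡ-≤ N (*-monoʳ-≤ n upper)) ⟩
    16 * (n * (64 * (q * q) * t) * N)  ≡⟨ arith₃ n (q * q) t N ⟩
    t * n * (1024 * (q * q) * N)       ≡⟨ cong (λ z → t * n * (z * N)) c≡ ⟨
    t * n * (c * N)                    ∎)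
    where
    arith₁ : ∀ t n b → t * n * (t * b) ≡ t * t * n * b
    arith₁ = solve-∀
    arith₂ : ∀ L N → 8 * (4 * L * N) ≡ 16 * (2 * L * N)
    arith₂ = solve-∀
    arith₃ : ∀ n s t N → 16 * (n * (64 * s * t) * N) ≡ t * n * (1024 * s * N)
    arith₃ = solve-∀
    arith₄ : ∀ a b → a * (a * b) ≡ a * a * b
    arith₄ = solve-∀
    arith₅ : ∀ D b → 2 * D * (2 * D) * b ≡ 4 * (D * D * b)
    arith₅ = solve-∀
    arith₆ : ∀ L a N → 4 * (L * a * N) ≡ a * (4 * L * N)
    arith₆ = solve-∀
    mw≢0 : NonZero (m * w)
    mw≢0 = m*n≢0⇒n≢0 8 {{>-nonZero (≤-trans (>-nonZero⁻¹ (t * t * n) {{m*n≢0 _ n {{m*n≢0 t t}}}}) t²n≤8mw)}}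
    reduced : m * w * Bad ≤ 4 * L * N
    reduced = *-cancelˡ-≤ (m * w) {{mw≢0}} (begin
      m * w * (m * w * Bad)            ≡⟨ arith₄ (m * w) Bad ⟩
      m * w * (m * w) * Bad            ≤⟨ *-monoˡ-≤ Bad (*-mono-≤ mw≤2D₂ mw≤2D₂) ⟩
      2 * D₂ * (2 * D₂) * Bad          ≡⟨ arith₅ D₂ Bad ⟩
      4 * (D₂ * D₂ * Bad)              ≤⟨ *-monoʳ-≤ 4 le ⟩
      4 * (L * (m * w) * N)            ≡⟨ arith₆ L (m * w) N ⟩
      m * w * (4 * L * N)              ∎)

-- Union bound over the two bad events

∈-sublists⇒length : ∀ {a} {A : Set a} m (K : List A) {G} → G ∈ sublists m K → length G ≡ m
∈-sublists⇒length zero    K       (here refl) = refl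
∈-sublists⇒length (suc m) (x ∷ K) G∈ with ∈-++⁻ (map (x ∷_) (sublists m K)) G∈
... | inj₂ G∈K = ∈-sublists⇒length (suc m) K G∈K
... | inj₁ G∈x with ∈-map⁻ (x ∷_) G∈x
... | H , H∈ , refl = cong suc (∈-sublists⇒length m K H∈)

-- Tags marking a block of positions. Selecting tags by a string `s` and counting the selected
-- `true` ones gives the number of ones of `s` inside the block. Thus a count over random strings
-- becomes a count over random sublists of a fixed list, to which the moment computation applies.
prefix suffix : ℕ → ℕ → List Bool
prefix q r = replicate q true ++ replicate r false
suffix r w = replicate r false ++ replicate w true

ones-replicate-false : ∀ r → ones (replicate r false) ≡ 0
ones-replicate-false zero    = refl
ones-replicate-false (suc r) = ones-replicate-false r

ones-replicate-true : ∀ w → ones (replicate w true) ≡ w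
ones-replicate-true zero    = refl
ones-replicate-true (suc w) = cong suc (ones-replicate-true w)

ones-prefix : ∀ q r → ones (prefix q r) ≡ q
ones-prefix q r = begin
  ones (prefix q r)                                        ≡⟨ ones-++ (replicate q true) _ ⟩
  ones (replicate q true) + ones (replicate r false)       ≡⟨ cong₂ _+_ (ones-replicate-true q) (ones-replicate-false r) ⟩
  q + 0                                                    ≡⟨ +-identityʳ q ⟩
  q                                                        ∎
  where open ≡-Reasoning

ones-suffix : ∀ r w → ones (suffix r w) ≡ w
ones-suffix r w = trans (ones-++ (replicate r false) _) (cong₂ _+_ (ones-replicate-false r) (ones-replicate-true w))

length-prefix : ∀ q r → length (prefix q r) ≡ q + r
length-prefix q r = trans (length-++ (replicate q true)) (cong₂ _+_ (length-replicate q) (length-replicate r))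

length-suffix : ∀ r w → length (suffix r w) ≡ r + w
length-suffix r w = trans (length-++ (replicate r false)) (cong₂ _+_ (length-replicate r) (length-replicate w))

select-prefix : ∀ q r s → ones (select s (prefix q r)) ≡ ones (take q s)
select-prefix zero    zero    []          = refl
select-prefix zero    (suc r) []          = refl
select-prefix zero    zero    (b ∷ s)     = refl
select-prefix zero    (suc r) (true ∷ s)  = select-prefix zero r s
select-prefix zero    (suc r) (false ∷ s) = select-prefix zero r s
select-prefix (suc q) r       []          = refl
select-prefix (suc q) r       (true ∷ s)  = cong suc (select-prefix q r s)
select-prefix (suc q) r       (false ∷ s) = select-prefix q r s

select-suffix : ∀ r w s → length s ≡ r + w → ones (select s (suffix r w)) ≡ ones (drop r s)
select-suffix zero    zero    []          len = refl
select-suffix zero    (suc w) (true ∷ s)  len = cong suc (select-suffix zero w s (suc-injective len))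
select-suffix zero    (suc w) (false ∷ s) len = select-suffix zero w s (suc-injective len)
select-suffix (suc r) w       (true ∷ s)  len = select-suffix r w s (suc-injective len)
select-suffix (suc r) w       (false ∷ s) len = select-suffix r w s (suc-injective len)

chebyshev-≥2 : ∀ m T x D → 2 ≤ length T → 2 ≤ m → D + length T * x ≤ m * ones T →
  D * D * cnt m T (λ G → bit (does (ones G <? x))) ≤ length T * (m * ones T) * (length T C m)
chebyshev-≥2 (suc (suc j)) (a ∷ b ∷ T) x D _             _              le = chebyshev j a b T x D le
chebyshev-≥2 _             (a ∷ [])    x D (s≤s ())      _              le
chebyshev-≥2 (suc zero)    (a ∷ b ∷ T) x D _             (s≤s ())       le

tail-bound : ∀ {L A} m T x D → length T ≡ L → ones T ≡ A → 2 ≤ L → 2 ≤ m → D + L * x ≤ m * A →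
  D * D * cnt m T (λ G → bit (does (ones G <? x))) ≤ L * (m * A) * (L C m)
tail-bound m T x D refl refl = chebyshev-≥2 m T x D

-- The bad proportions are at most a/t and c/t, together at most 1/(E + 1); all divisions are
-- cleared.
mostly-good : ∀ E a c t .{{_ : NonZero t}} {good bad₁ bad₂ all} →
  t * bad₁ ≤ a * all → t * bad₂ ≤ c * all → suc E * (a + c) ≤ t → all ≤ good + (bad₁ + bad₂) →
  E * all ≤ good * suc E
mostly-good E a c t {good} {bad₁} {bad₂} {all} le₁ le₂ large cover = +-cancelʳ-≤ all _ _ (begin
  E * all + all                               ≡⟨ +-comm (E * all) all ⟩
  suc E * all                                 ≤⟨ *-monoʳ-≤ (suc E) cover ⟩
  suc E * (good + (bad₁ + bad₂))              ≡⟨ arith (suc E) good (bad₁ + bad₂) ⟩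
  good * suc E + suc E * (bad₁ + bad₂)        ≤⟨ +-monoʳ-≤ (good * suc E) few ⟩
  good * suc E + all                          ∎)
  where
  open ≤-Reasoning
  arith : ∀ e g b → e * (g + b) ≡ g * e + e * b
  arith = solve-∀
  arith₁ : ∀ t e a b → t * (e * (a + b)) ≡ e * (t * a + t * b)
  arith₁ = solve-∀
  arith₂ : ∀ e a c n → e * (a * n + c * n) ≡ e * (a + c) * n
  arith₂ = solve-∀
  few : suc E * (bad₁ + bad₂) ≤ all
  few = *-cancelˡ-≤ t (begin
    t * (suc E * (bad₁ + bad₂))           ≡⟨ arith₁ t (suc E) bad₁ bad₂ ⟩
    suc E * (t * bad₁ + t * bad₂)         ≤⟨ *-monoʳ-≤ (suc E) (+-mono-≤ le₁ le₂) ⟩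
    suc E * (a * all + c * all)           ≡⟨ arith₂ (suc E) a c all ⟩
    suc E * (a + c) * all                 ≤⟨ *-monoˡ-≤ all large ⟩
    t * all                               ∎)

good-or-bad : ∀ {x y h z} (good : Dec (x ≤ y × h ≤ z)) (bad₁ : Dec (y < x)) (bad₂ : Dec (z < h)) →
  1 ≤ bit (does good) + (bit (does bad₁) + bit (does bad₂))
good-or-bad (yes _)    _        _        = s≤s z≤n
good-or-bad (no _)     (yes _)  _        = s≤s z≤n
good-or-bad (no _)     (no _)   (yes _)  = s≤s z≤n
good-or-bad (no ¬good) (no y≮x) (no z≮h) = contradiction (≮⇒≥ y≮x , ≮⇒≥ z≮h) ¬good

module _ (p B u n m c E : ℕ) (c≡ : c ≡ 1024 * (suc p * suc p))
  (1≤u : 1 ≤ u) (lower : 32 * (suc p * suc p) * (c * u) ≤ n) (upper : n ≤ 64 * (suc p * suc p) * (c * u))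
  (dense : suc (suc p) * n ≤ 2 * suc p * suc m) (m≤Bn : m ≤ B * n) (2B<n : 2 * B < n)
  (large : suc E * (32 * (suc p * B) + c) ≤ u) where

  private
    open module P = Parameters p B u n m c c≡ 1≤u lower upper dense m≤Bn 2B<n using (q; t; k; x; ρ; h; L; w; D₁; D₂; t≢0)
    r = L ∸ w
    r+w : r + w ≡ L
    r+w = m∸n+n≡m (tri-mono P.t≤n)
    kρ+ : k * ρ + (L ∸ k * ρ) ≡ L
    kρ+ = m+[n∸m]≡n P.kρ≤L
    open Exploration {n} {k} {ρ} {x} {t} {r} {h} {u} P.k≤n P.k+ρ+t≤n ≤-refl P.u<h
    2≤L = ≤-trans P.2≤m P.m≤L
    K = completeGraph n
    T₁ = prefix (k * ρ) (L ∸ k * ρ)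
    T₂ = suffix r w
    φ = λ (G : Graph n) → bit (does (excess? u G))
    bad : ℕ → List Bool → ℕ
    bad x G = bit (does (ones G <? x))
    length-T₁ = trans (length-prefix (k * ρ) _) kρ+
    length-T₂ = trans (length-suffix r w) r+w
    length-K : length K ≡ L
    length-K = length-completeGraph {n}

  excess-nonempty : NonZero (length (graphs n m))
  excess-nonempty = >-nonZero (subst (0 <_) (sym (trans (sym (total-1 (graphs n m))) (cnt-1 m K)))
    (nCk>0 (subst (m ≤_) (sym length-K) P.m≤L)))

  excess-likely : E * (1 * length (graphs n m)) ≤ total φ (graphs n m) * suc E
  excess-likely = subst (λ z → E * z ≤ cnt m K φ * suc E) (sym size)
    (mostly-good E (32 * (q * B)) c t {cnt m K φ} {Bad₁} {Bad₂} {L C m} few₁ few₂ large′ cover)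
    where
    open ≤-Reasoning
    Bad₁ = cnt m T₁ (bad x)
    Bad₂ = cnt m T₂ (bad h)
    few₁ : t * Bad₁ ≤ 32 * (q * B) * (L C m)
    few₁ = P.few₁ Bad₁ (L C m) (tail-bound m T₁ x D₁ length-T₁ (ones-prefix (k * ρ) (L ∸ k * ρ)) 2≤L P.2≤m P.D₁+Lx)
    few₂ : t * Bad₂ ≤ c * (L C m)
    few₂ = P.few₂ Bad₂ (L C m) (tail-bound m T₂ h D₂ length-T₂ (ones-suffix r w) 2≤L P.2≤m P.D₂+Lh)
    large′ : suc E * (32 * (q * B) + c) ≤ t
    large′ = ≤-trans large (≤-trans (m≤n*m u 16) P.16u≤t)
    size : 1 * length (graphs n m) ≡ L C m
    size = trans (*-identityˡ _) (trans (sym (total-1 (graphs n m))) (trans (cnt-1 m K) (cong (_C m) length-K)))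
    ψ bad₁ bad₂ : List Bool → ℕ
    ψ s = bit (does (good? s))
    bad₁ s = bad x (select s T₁)
    bad₂ s = bad h (select s T₂)
    some : ∀ s → length s ≡ length K → 1 ≤ ψ s + (bad₁ s + bad₂ s)
    some s len = subst₂ (λ y z → 1 ≤ ψ s + (bit (does (y <? x)) + bit (does (z <? h))))
      (sym (select-prefix (k * ρ) (L ∸ k * ρ) s))
      (sym (select-suffix r w s (trans len (trans length-K (sym r+w)))))
      (good-or-bad (good? s) (ones (take (k * ρ) s) <? x) (ones (drop r s) <? h))
    -- Each string is good or bad in one of two ways. The good ones are dominated by the graphs with
    -- excess, and the bad ones are counted on the tag lists.
    cover : L C m ≤ cnt m K φ + (cnt m T₁ (bad x) + cnt m T₂ (bad h))
    cover = begin
      L C m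
        ≡⟨ cong (_C m) length-K ⟨
      length K C m
        ≡⟨ cnt-1 m K ⟨
      cnt m K (const 1)
        ≡⟨ cnt-select m K (const 1) ⟩
      cntᵇ (length K) m (const 1)
        ≤⟨ cntᵇ-mono (length K) m some ⟩
      cntᵇ (length K) m (λ s → ψ s + (bad₁ s + bad₂ s))
        ≡⟨ trans (cntᵇ-+ (length K) m ψ _) (cong (cntᵇ (length K) m ψ +_) (cntᵇ-+ (length K) m bad₁ bad₂)) ⟩
      cntᵇ (length K) m ψ + (cntᵇ (length K) m bad₁ + cntᵇ (length K) m bad₂)
        ≤⟨ +-monoˡ-≤ _ (explored r+w m) ⟩
      cnt m K φ + (cntᵇ (length K) m bad₁ + cntᵇ (length K) m bad₂)
        ≡⟨ cong (cnt m K φ +_) (cong₂ _+_ (tags T₁ length-T₁ (bad x)) (tags T₂ length-T₂ (bad h))) ⟩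
      cnt m K φ + (cnt m T₁ (bad x) + cnt m T₂ (bad h)) ∎
      where
      tags : ∀ T → length T ≡ L → ∀ f → cntᵇ (length K) m (λ s → f (select s T)) ≡ cnt m T f
      tags T len f = trans (cong (λ l → cntᵇ l m (λ s → f (select s T))) (trans length-K (sym len))) (sym (cnt-select m T f))

-- From excess to the average error and its probability

excess⇒err : ∀ {n} N .{{_ : NonZero N}} {G : Graph n} {σ X F} .{{_ : NonZero F}} →
  σ ∈ balancedSequences N G → NonZero (length G) → Excess X G → 2 * length G ≤ X * F →
  ℤ.+ 1 ℚ./ F ℚ.≤ err N G σ
excess⇒err N {G} {σ} {X} {F} σ∈ G≢[] ex le =
  average-lower N (λ e → edgeCounter (run σ) e ∸ N) (relativeError N σ) G G≢[]
    -- Since c_e ≥ N, the integer difference in the relative error is the natural number c_e ∸ N.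
    (λ e e∈ → ℚ.≤-reflexive (cong (ℚ._/ N) (sym (trans (ℤ.m-n≡m⊖n (edgeCounter (run σ) e) N) (ℤ.⊖-≥ (N≤edgeCounter N {G} {σ} σ∈ e∈))))))
    {1} {F}
    (*-cancelˡ-≤ 2 (begin
      2 * (1 * (N * length G))                                    ≡⟨ arith N (length G) ⟩
      N * (2 * length G)                                          ≤⟨ *-monoʳ-≤ N le ⟩
      N * (X * F)                                                 ≡⟨ *-assoc N X F ⟨
      N * X * F                                                   ≤⟨ *-monoˡ-≤ F (excess⇒error N {G} {σ} σ∈ {X} ex) ⟩
      2 * total (λ e → edgeCounter (run σ) e ∸ N) G * F           ≡⟨ *-assoc 2 (total (λ e → edgeCounter (run σ) e ∸ N) G) F ⟩
      2 * (total (λ e → edgeCounter (run σ) e ∸ N) G * F)         ∎))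
  where
  open ≤-Reasoning
  arith : ∀ N l → 2 * (1 * (N * l)) ≡ N * (2 * l)
  arith = solve-∀

-- A graph with excess satisfies the error bound for every sequence of draws, so its inner average
-- is 1, whatever `N` is; the other graphs contribute at least 0.
excess⇒ℙ : ∀ {n m} N .{{_ : NonZero N}} {X F E} .{{_ : NonZero F}} → 1 ≤ m → 2 * m ≤ X * F →
  NonZero (length (graphs n m)) →
  E * (1 * length (graphs n m)) ≤ total (λ G → bit (does (excess? X G))) (graphs n m) * suc E →
  ℤ.+ E ℚ./ suc E ℚ.≤ ℙ[err≥ ℤ.+ 1 ℚ./ F ] N n m
excess⇒ℙ {n} {m} N {X} {F} {E} 1≤m le nonempty likely =
  average-lower 1 (λ G → bit (does (excess? X G))) _ (graphs n m) nonempty certain {E} {suc E} likely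
  where
  f = ℤ.+ 1 ℚ./ F
  event : Graph n → List (Edge n) → ℚ
  event G σ = indicator (does (f ℚ.≤? err N G σ))
  0≤indicator : ∀ b → ℤ.+ 0 ℚ./ 1 ℚ.≤ indicator b
  0≤indicator true  = /-≤ {0} {1} {1} {1} z≤n
  0≤indicator false = ℚ.≤-refl
  certain : ∀ G → G ∈ graphs n m → ℤ.+ bit (does (excess? X G)) ℚ./ 1 ℚ.≤ average (balancedSequences N G) (event G)
  certain G G∈ with excess? X G
  ... | no _   = average-lower 1 (const 0) (event G) (balancedSequences N G) (permutations≢[] (concatMap (replicate N) G))
    (λ σ _ → 0≤indicator (does (f ℚ.≤? err N G σ))) {0} {1} z≤n
  ... | yes ex = average-lower 1 (const 1) (event G) (balancedSequences N G) (permutations≢[] (concatMap (replicate N) G))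
    (λ σ σ∈ → ℚ.≤-reflexive (sym (cong indicator (dec-true (f ℚ.≤? err N G σ) (error σ∈)))))
    {1} {1} (≤-reflexive (trans (trans (*-identityˡ _) (*-identityˡ _)) (trans (sym (total-1 (balancedSequences N G))) (sym (*-identityʳ _)))))
    where
    length-G : length G ≡ m
    length-G = ∈-sublists⇒length m (completeGraph n) G∈
    error : ∀ {σ} → σ ∈ balancedSequences N G → f ℚ.≤ err N G σ
    error {σ} σ∈ = excess⇒err N {G} {σ} {X} {F} σ∈ (>-nonZero (subst (1 ≤_) (sym length-G) 1≤m)) ex (subst (λ l → 2 * l ≤ X * F) (sym length-G) le)

quotient-lower : ∀ v g n .{{_ : NonZero g}} → g * v ≤ n → v ≤ n / g
quotient-lower v g n le = subst (_≤ n / g) (m*n/n≡m v g) (/-monoˡ-≤ g (≤-trans (≤-reflexive (*-comm v g)) le))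

-- With u = n / g ≥ 1, n < (u + 1) g ≤ 2 g u. This is the factor 2 between the lower and the upper
-- bound on n in terms of t.
quotient-upper : ∀ g n .{{_ : NonZero g}} → 1 ≤ n / g → n ≤ 2 * g * (n / g)
quotient-upper g n 1≤ = begin
  n                          ≡⟨ m≡m%n+[m/n]*n n g ⟩
  n % g + n / g * g          ≤⟨ +-monoˡ-≤ (n / g * g) (<⇒≤ (m%n<n n g)) ⟩
  g + n / g * g              ≡⟨ cong (_+ n / g * g) (*-identityˡ g) ⟨
  1 * g + n / g * g          ≤⟨ +-monoˡ-≤ (n / g * g) (*-monoˡ-≤ g 1≤) ⟩
  n / g * g + n / g * g      ≡⟨ arith (n / g) g ⟩
  2 * g * (n / g)            ∎
  where
  open ≤-Reasoning
  open import Data.Nat.Base using (_%_)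
  arith : ∀ a g → a * g + a * g ≡ 2 * g * a
  arith = solve-∀

module Constants (p B c g : ℕ) .{{_ : NonZero B}}
  (c≡ : c ≡ 1024 * (suc p * suc p)) (g≡ : g ≡ 32 * (suc p * suc p) * c) where

  private
    q = suc p

  instance
    g≢0 : NonZero g
    g≢0 = subst NonZero (sym g≡) (m*n≢0 (32 * (q * q)) c {{m*n≢0 32 (q * q)}} {{subst NonZero (sym c≡) (m*n≢0 1024 (q * q))}})

  -- An excess of u gives an average error of at least u / (2m), and m ≤ B n ≤ 2 B g u; hence the
  -- error bound 1/F.
  F : ℕ
  F = 4 * (B * g)

  instance
    F≢0 : NonZero F
    F≢0 = m*n≢0 4 (B * g) {{_}} {{m*n≢0 B g}}

  -- The bracket is a lower bound for u = n / g. Its summands provide 1 ≤ u, then 2 B < n, by which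
  -- m edges fit into the complete graph, and the size at which the two bad events have total
  -- proportion at most 1/(E + 1).
  threshold : ℕ → ℕ
  threshold E = g * (1 + 2 * B + suc E * (32 * (q * B) + c))

  likely : ∀ E N .{{_ : NonZero N}} n m → threshold E ≤ n → suc q * n ≤ 2 * q * suc m → m ≤ B * n →
    ℤ.+ E ℚ./ suc E ℚ.≤ ℙ[err≥ ℤ.+ 1 ℚ./ F ] N n m
  likely E N n m M≤n dense m≤Bn =
    excess⇒ℙ {n} {m} N {u} {F} {E} {{F≢0}} 1≤m 2m≤uF
      (excess-nonempty p B u n m c E c≡ 1≤u lower upper dense m≤Bn 2B<n large)
      (excess-likely p B u n m c E c≡ 1≤u lower upper dense m≤Bn 2B<n large)
    where
    open ≤-Reasoning
    u = n / g
    v≤u : 1 + 2 * B + suc E * (32 * (q * B) + c) ≤ u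
    v≤u = quotient-lower (1 + 2 * B + suc E * (32 * (q * B) + c)) g n M≤n
    1+2B≤u : 1 + 2 * B ≤ u
    1+2B≤u = m+n≤o⇒m≤o (1 + 2 * B) v≤u
    1≤u : 1 ≤ u
    1≤u = m+n≤o⇒m≤o 1 1+2B≤u
    large : suc E * (32 * (q * B) + c) ≤ u
    large = m+n≤o⇒n≤o (1 + 2 * B) v≤u
    gu≤n : g * u ≤ n
    gu≤n = ≤-trans (≤-reflexive (*-comm g u)) (m/n*n≤m n g)
    lower : 32 * (q * q) * (c * u) ≤ n
    lower = ≤-trans (≤-reflexive (trans (sym (*-assoc (32 * (q * q)) c u)) (cong (_* u) (sym g≡)))) gu≤n
    n≤2gu : n ≤ 2 * g * u
    n≤2gu = quotient-upper g n 1≤u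
    upper : n ≤ 64 * (q * q) * (c * u)
    upper = ≤-trans n≤2gu (≤-reflexive (trans (cong (λ g → 2 * g * u) g≡) (arith (q * q) c u)))
      where
      arith : ∀ s c u → 2 * (32 * s * c) * u ≡ 64 * s * (c * u)
      arith = solve-∀
    2B<n : 2 * B < n
    2B<n = ≤-trans 1+2B≤u (≤-trans (m≤n*m u g) gu≤n)
    1≤m : 1 ≤ m
    1≤m = ≤-trans (s≤s z≤n) (Parameters.2≤m p B u n m c c≡ 1≤u lower upper dense m≤Bn 2B<n)
    2m≤uF : 2 * m ≤ u * F
    2m≤uF = begin
      2 * m                      ≤⟨ *-monoʳ-≤ 2 (≤-trans m≤Bn (*-monoʳ-≤ B n≤2gu)) ⟩
      2 * (B * (2 * g * u))      ≡⟨ arith B g u ⟩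
      u * F                      ∎
      where
      arith : ∀ B g u → 2 * (B * (2 * g * u)) ≡ u * (4 * (B * g))
      arith = solve-∀

  nearly-certain : ∀ λ₀ →
    (∀ m n .{{_ : NonZero n}} → λ₀ ℝ<ℚ ℤ.+ suc m ℚ./ n → suc q * n ≤ 2 * q * suc m) →
    (∀ m n .{{_ : NonZero n}} → ℤ.+ m ℚ./ n ℚ≤ℝ λ₀ → m ≤ B * n) →
    ∃[ f ] (0ℚ ℚ.< f ×
    ((ε : ℝ) → 0ℚ ℚ<ℝ ε →
    ∃[ M ] ((N : ℕ) .{{_ : NonZero N}} (n : ℕ) .{{_ : NonZero n}} → M ≤ n →
    (m : ℕ) → IsFloor m λ₀ n →
    1ℚ ℚ.- ℙ[err≥ f ] N n m ℚ≤ℝ ε)))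
  nearly-certain λ₀ dense bound =
    ℤ.+ 1 ℚ./ F , ℚ.positive⁻¹ (ℤ.+ 1 ℚ./ F) {{ℚ.normalize-pos 1 F}} , λ ε 0<ε →
      let E , below = reciprocal-below ε 0<ε in
      threshold E , λ N n M≤n m floor →
        below (ℙ[err≥ ℤ.+ 1 ℚ./ F ] N n m)
          (likely E N n m M≤n (dense m n (proj₂ floor)) (bound m n (proj₁ floor)))

theorem3 : (λ₀ : ℝ) → ½ ℚ<ℝ λ₀ →
    ∃[ f ] (0ℚ ℚ.< f ×
    ((ε : ℝ) → 0ℚ ℚ<ℝ ε →
    ∃[ M ] ((N : ℕ) .{{_ : NonZero N}} (n : ℕ) .{{_ : NonZero n}} → M ≤ n →
    (m : ℕ) → IsFloor m λ₀ n →
    1ℚ ℚ.- ℙ[err≥ f ] N n m ℚ≤ℝ ε)))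
theorem3 λ₀ ½<λ₀ with supercritical λ₀ ½<λ₀ | bounded λ₀
... | suc p , _ , dense | B , bound =
  -- The successor makes the bound on λ nonzero, as the denominator `F` requires.
  Constants.nearly-certain p (suc B) _ _ refl refl λ₀ dense
    λ m n m≤λn → ≤-trans (bound m n m≤λn) (*-monoˡ-≤ n (n≤1+n B))
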